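{- There exist an absolute constant $C>0$ and a sequence $(\delta_k)_{k\ge 2}$ of real numbers with $\delta_k\to 0$ as $k\to\infty$ such that for all integers $n\ge k\ge 2$, all but at most a $\delta_k$ fraction of the $k$-juntas $f:\mathbb{Z}_2^n\to\mathbb{Z}_2$ are $q$-locally correctable for $\varepsilon=0.001$ by an algorithm using $q\le C\,k\log^2 k$ non-adaptive queries.
   Context: For $f:\mathbb{Z}_2^n\to\mathbb{Z}_2$ and a permutation $\sigma\in\mathcal{S}_n$, let $f_\sigma(x_1,\dots,x_n)=f(x_{\sigma(1)},\dots,x_{\sigma(n)})$; such an $f_\sigma$ is called an isomorphism of $f$. Two functions $f,g:\mathbb{Z}_2^n\to\mathbb{Z}_2$ are $\varepsilon$-close if $\Pr_x[f(x)\ne g(x)]\le\varepsilon$ for uniformly random $x\in\mathbb{Z}_2^n$. Local correction: $f$ (known to the algorithm) is $q$-locally correctable for $\varepsilon>0$ if there is a randomized algorithm which, for every $\sigma\in\mathcal{S}_n$, every $g$ that is $\varepsilon$-close to $f_\sigma$, and every $x\in\mathbb{Z}_2^n$, given $x$ and black-box (query) access to $g$ (but not $\sigma$), outputs $f_\sigma(x)$ with probability at least $2/3$ using at most $q$ queries to $g$. The algorithm is non-adaptive if its query points do not depend on answers to earlier queries (they may depend on $f$, on $x$ and on the algorithm's randomness). No restriction is put on computation time. A $k$-junta is a function depending only on (at most) $k$ of its input variables. Its core $f_{\mathrm{core}}:\mathbb{Z}_2^k\to\mathbb{Z}_2$ is $f$ viewed as a function of its $k$ junta variables in their natural order. Local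 correctability is invariant under isomorphism of $f$, and the fraction of $k$-juntas having a property is measured by choosing the core uniformly at random among all functions $\mathbb{Z}_2^k\to\mathbb{Z}_2$ (with a fixed set of $k$ junta variables). -}

module Defs where

open import Data.Bool using (Bool; true; false)
open import Data.Bool.Properties using (_≟_)
open import Data.Fin as Fin using (Fin)
open import Data.Fin.Permutation using (Permutation′; _⟨$⟩ʳ_)
open import Data.Integer using (+_)
open import Data.List using (List; []; _∷_; _++_; map; length; filter; allFin)
open import Data.List.Relation.Unary.Any using (Any)
open import Data.Nat using (ℕ; zero; suc; _*_; _^_; NonZero) renaming (_≤_ to _≤ℕ_)
open import Data.Nat.Logarithm using (⌊log₂_⌋)
open import Data.Nat.Properties using (m^n≢0)
open import Data.Product using (Σ; Σ-syntax; ∃-syntax; _×_)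
open import Data.Rational.Unnormalised using (ℚᵘ; 0ℚᵘ; _/_; _≤_; _<_; ∣_∣)
open import Data.Vec using (Vec; []; _∷_; lookup; tabulate)
open import Relation.Binary.PropositionalEquality using (_≗_)
open import Relation.Nullary using (¬_; ¬?)

-- ℤ₂ is represented by Bool: only its two-element set structure is used.
Point : ℕ → Set
Point n = Vec Bool n

BoolFun : ℕ → Set
BoolFun n = Point n → Bool

points : ∀ n → List (Point n)
points zero    = [] ∷ []
points (suc n) = map (false ∷_) (points n) ++ map (true ∷_) (points n)

permuteFun : ∀ {n} → Permutation′ n → BoolFun n → BoolFun n
permuteFun σ f x = f (tabulate λ i → lookup x (σ ⟨$⟩ʳ i))

-- Pr[ f x ≠ g x ] for x uniform on the 2 ^ n points.
distance : ∀ {n} → BoolFun n → BoolFun n → ℚᵘ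
distance {n} f g =
  (+ length (filter (λ x → ¬? (f x ≟ g x)) (points n)) / (2 ^ n)) {{m^n≢0 2 n}}

Close : ∀ {n} → ℚᵘ → BoolFun n → BoolFun n → Set
Close ε f g = distance f g ≤ ε

-- The randomness is a seed drawn uniformly from Fin seeds.  This realises every
-- rational distribution on deterministic algorithms.  The success requirements
-- below form a finite system of linear inequalities with rational coefficients,
-- so allowing real probabilities would not change what is achievable.
--
-- Non-adaptivity: the queries are fixed by the seed and the input point alone;
-- the oracle's answers are seen only by `decide`.
record NonAdaptiveAlgorithm (n : ℕ) : Set where
  field
    seeds       : ℕ
    {{seeds≢0}} : NonZero seeds
    queries     : Fin seeds → Point n → List (Point n)
    decide      : Fin seeds → Point n → List Bool → Bool

  run : BoolFun n → Fin seeds → Point n → Bool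
  run g r x = decide r x (map g (queries r x))

  Pr[run_at_≡_] : BoolFun n → Point n → Bool → ℚᵘ
  Pr[run g at x ≡ b ] =
    + length (filter (λ r → run g r x ≟ b) (allFin seeds)) / seeds

open NonAdaptiveAlgorithm public

-- The algorithm is chosen after f but before σ, g and x.
NonAdaptivelyLocallyCorrectable : ∀ {n} → ℕ → ℚᵘ → BoolFun n → Set
NonAdaptivelyLocallyCorrectable {n} q ε f =
  Σ[ A ∈ NonAdaptiveAlgorithm n ]
    (∀ r x → length (queries A r x) ≤ℕ q) ×
    (∀ (σ : Permutation′ n) (g : BoolFun n) → Close ε g (permuteFun σ f) →
     ∀ x → + 2 / 3 ≤ Pr[run_at_≡_] A g x (permuteFun σ f x))

-- A k-element set of variables, listed in its natural order.
record JuntaVariables (n k : ℕ) : Set where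
  field
    var        : Fin k → Fin n
    increasing : ∀ {i j} → i Fin.< j → var i Fin.< var j

open JuntaVariables public

-- The k-junta on the variables J with the given core.
junta : ∀ {n k} → JuntaVariables n k → BoolFun k → BoolFun n
junta J core x = core (tabulate λ i → lookup x (var J i))

-- All but at most a δ fraction of the 2 ^ (2 ^ k) functions ℤ₂ᵏ → ℤ₂, taken up
-- to pointwise equality, satisfy P.  The exceptions are covered by a list, so
-- that P need not be decidable for the fraction to make sense.
AllButFraction : ∀ {k} → ℚᵘ → (BoolFun k → Set) → Set
AllButFraction {k} δ P =
  Σ[ bad ∈ List (BoolFun k) ]
    ((+ length bad / (2 ^ (2 ^ k))) {{m^n≢0 2 (2 ^ k)}} ≤ δ) ×
    (∀ c → ¬ Any (c ≗_) bad → P c)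

TendsToZero : (ℕ → ℚᵘ) → Set
TendsToZero δ = ∀ ε → 0ℚᵘ < ε → ∃[ K ] (∀ k → K ≤ℕ k → ∣ δ k ∣ < ε)

-- C k log² k.  For k ≥ 2, ⌊log₂ k⌋ and log k agree up to constant factors, so
-- under an existential constant C the rounding and the base are immaterial.
queryBound : ℕ → ℕ → ℕ
queryBound C k = C * (k * ⌊log₂ k ⌋ ^ 2)

{-# OPTIONS --safe #-}
module Submission where

open import Data.Bool using (Bool; true; false; not; _xor_; _∧_)
open import Data.Bool.Properties using (_≟_; xor-comm)
open import Data.Empty using (⊥-elim)
open import Data.Fin as Fin using (Fin)
open import Data.Fin.Permutation using (Permutation′; _⟨$⟩ʳ_; _⟨$⟩ˡ_; inverseˡ)
import Data.Fin.Properties as Fin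
open import Data.Integer using (+_)
import Data.Integer as ℤ
import Data.Integer.Properties as ℤ
open import Data.List as List using (List; []; _∷_; _++_; map; length; filter; allFin; take; cartesianProduct; cartesianProductWith)
open import Data.List.Membership.Propositional using (_∈_; _∉_; lose)
open import Data.List.Membership.Propositional.Properties using (∈-++⁺ˡ; ∈-++⁺ʳ; ∈-++⁻; ∈-map⁺; ∈-map⁻; ∈-cartesianProduct⁺; ∈-cartesianProductWith⁺; ∈-filter⁺; ∈-filter⁻; ∈-tabulate⁻; ∈-allFin)
open import Data.List.Properties using (length-map; length-++; length-filter; length-take; length-tabulate; filter-all; map-∘; map-tabulate; tabulate-lookup)
open import Data.List.Relation.Unary.All as All using (All; []; _∷_)
import Data.List.Relation.Unary.All.Properties as All
open import Data.List.Relation.Unary.AllPairs using (AllPairs; []; _∷_)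
import Data.List.Relation.Unary.AllPairs.Properties as AllPairs
open import Data.List.Relation.Unary.Any using (Any; here; there)
open import Data.List.Relation.Unary.Unique.Propositional using (Unique)
import Data.List.Relation.Unary.Unique.Propositional.Properties as Unique
open import Data.Nat using (ℕ; zero; suc; _+_; _*_; _^_; _∸_; _≤_; _<_; z≤n; s≤s; NonZero; >-nonZero; ⌊_/2⌋; ⌈_/2⌉)
open import Data.Nat.Induction using (<-rec)
open import Data.Nat.Logarithm using (⌊log₂_⌋; ⌊log₂⌋-mono-≤; ⌊log₂[2^n]⌋≡n; ⌊log₂⌊n/2⌋⌋≡⌊log₂n⌋∸1)
open import Data.Nat.Properties hiding (_≟_)
open import Data.Nat.Tactic.RingSolver using (solve-∀)
open import Data.Product using (Σ-syntax; ∃-syntax; _×_; _,_; proj₁; proj₂)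
open import Data.Rational.Unnormalised using (ℚᵘ; mkℚᵘ; _/_; *≤*; *<*; ∣_∣) renaming (_≤_ to _≤ᵘ_; _<_ to _<ᵘ_)
open import Data.Sum using (inj₁; inj₂)
open import Data.Vec as Vec using (Vec; []; _∷_; head; tail; lookup; tabulate; zipWith)
open import Data.Vec.Properties using (≡-dec; lookup-map; lookup∘tabulate; tabulate-cong; lookup-zipWith; tabulate-∘; map-cong)
open import Function using (_∘_; id)
open import Relation.Binary.Definitions using (tri<; tri≈; tri>)
open import Relation.Binary.PropositionalEquality using (_≡_; _≢_; _≗_; refl; sym; trans; cong; cong₂; subst; subst₂; module ≡-Reasoning)
open import Relation.Nullary using (¬_; Dec; yes; no; ¬?)
open import Relation.Unary using (Decidable)
open import Defs

-- A seed hashes every variable i to a cell hᵢ of a table of 2^μ ≥ 8k² cells and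
-- gives it a random sign sᵢ.  For a fixed z the query point with coordinates
-- sᵢ xor z(xᵢ, hᵢ) is exactly uniform, so on average only 0.001 of the answers
-- are corrupted, and with probability at least 7/8 the k relevant variables
-- lie in distinct cells.  The answers then only depend on the vector η of
-- triples (s, x, h) at the relevant variables, one of 2^(O(k log k)) hypotheses,
-- and η determines the value at x.  It remains to find O(k log k) functions z on
-- which any two hypotheses with different (x, h)-parts give answers that differ
-- in a constant fraction of the places.  For most cores such hypotheses differ on
-- at least 1/8 of all z (an exponential moment bound and a union bound over
-- 2^(O(k²)) events, each of probability exp(-Ω(2^k))), and then the z's can be
-- picked greedily.

-- The obstacle is that `σ` is unknown: the relevant variables may sit at any of the n coordinates.
-- One seed serves all the z's, so uncorrupted answers depend on k short table entries only, and
-- neither the number of hypotheses nor that of queries involves n. Reading z at (xᵢ, hᵢ) rather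
-- than at hᵢ writes the needed bits of x into the hypothesis. Hypotheses that differ in signs alone
-- give the same value at x and need not be told apart. For a random core, the agreements of two
-- hypotheses at different z involve the same 2^k values of the core, so they are not independent.
-- Independence is found within families of 2^(k-2) functions obtained from one z by toggling, and
-- averaging over all z passes from families to the whole. The constants: if 2^ℓ is the number of
-- pairs of hypotheses, 48ℓ samples give distance 3ℓ. Decoding tolerates fewer than 3ℓ/2 wrong
-- answers while 0.048ℓ are expected, so Markov's inequality bounds this failure by 0.032. Together
-- with 1/8 for collisions this stays below 1/3.

private variable
  A B : Set

-- Finite sums

∑ : List A → (A → ℕ) → ℕ
∑ []       f = 0
∑ (x ∷ xs) f = f x + ∑ xs f

infix 5 ∑
syntax ∑ xs (λ x → e) = ∑[ x ∈ xs ] e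

∑-cong-∈ : ∀ (xs : List A) {f g : A → ℕ} → (∀ {x} → x ∈ xs → f x ≡ g x) → ∑ xs f ≡ ∑ xs g
∑-cong-∈ []       f≗g = refl
∑-cong-∈ (x ∷ xs) f≗g = cong₂ _+_ (f≗g (here refl)) (∑-cong-∈ xs (f≗g ∘ there))

∑-cong : ∀ (xs : List A) {f g : A → ℕ} → f ≗ g → ∑ xs f ≡ ∑ xs g
∑-cong xs f≗g = ∑-cong-∈ xs (λ {x} _ → f≗g x)

∑-mono-∈ : ∀ (xs : List A) {f g : A → ℕ} → (∀ {x} → x ∈ xs → f x ≤ g x) → ∑ xs f ≤ ∑ xs g
∑-mono-∈ []       f≤g = z≤n
∑-mono-∈ (x ∷ xs) f≤g = +-mono-≤ (f≤g (here refl)) (∑-mono-∈ xs (f≤g ∘ there))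

∑-mono : ∀ (xs : List A) {f g : A → ℕ} → (∀ x → f x ≤ g x) → ∑ xs f ≤ ∑ xs g
∑-mono xs f≤g = ∑-mono-∈ xs (λ {x} _ → f≤g x)

∑-const : ∀ (xs : List A) c → (∑[ _ ∈ xs ] c) ≡ length xs * c
∑-const []       c = refl
∑-const (x ∷ xs) c = cong (_+_ c) (∑-const xs c)

+-interchange : ∀ a b c d → (a + b) + (c + d) ≡ (a + c) + (b + d)
+-interchange = solve-∀

∑-+ : ∀ (xs : List A) (f g : A → ℕ) → (∑[ x ∈ xs ] (f x + g x)) ≡ ∑ xs f + ∑ xs g
∑-+ []       f g = refl
∑-+ (x ∷ xs) f g = trans (cong (_+_ (f x + g x)) (∑-+ xs f g)) (+-interchange (f x) (g x) (∑ xs f) (∑ xs g))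

∑-* : ∀ (xs : List A) c (f : A → ℕ) → (∑[ x ∈ xs ] (c * f x)) ≡ c * ∑ xs f
∑-* []       c f = sym (*-zeroʳ c)
∑-* (x ∷ xs) c f = trans (cong (_+_ (c * f x)) (∑-* xs c f)) (sym (*-distribˡ-+ c (f x) (∑ xs f)))

∑-swap : ∀ (xs : List A) (ys : List B) (f : A → B → ℕ) →
         (∑[ x ∈ xs ] ∑[ y ∈ ys ] f x y) ≡ (∑[ y ∈ ys ] ∑[ x ∈ xs ] f x y)
∑-swap []       ys f = sym (trans (∑-const ys 0) (*-zeroʳ (length ys)))
∑-swap (x ∷ xs) ys f =
  trans (cong (_+_ (∑ ys (f x))) (∑-swap xs ys f)) (sym (∑-+ ys (f x) (λ y → ∑[ x ∈ xs ] f x y)))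

∑-++ : ∀ (xs ys : List A) (f : A → ℕ) → ∑ (xs ++ ys) f ≡ ∑ xs f + ∑ ys f
∑-++ []       ys f = refl
∑-++ (x ∷ xs) ys f = trans (cong (_+_ (f x)) (∑-++ xs ys f)) (sym (+-assoc (f x) (∑ xs f) (∑ ys f)))

∑-map : ∀ (h : A → B) (xs : List A) (f : B → ℕ) → ∑ (map h xs) f ≡ ∑ xs (f ∘ h)
∑-map h []       f = refl
∑-map h (x ∷ xs) f = cong (_+_ (f (h x))) (∑-map h xs f)

∑-cartesianProductWith : ∀ {C : Set} (h : A → B → C) (xs : List A) (ys : List B) (f : C → ℕ) →
  ∑ (cartesianProductWith h xs ys) f ≡ (∑[ x ∈ xs ] ∑[ y ∈ ys ] f (h x y))
∑-cartesianProductWith h []       ys f = refl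
∑-cartesianProductWith h (x ∷ xs) ys f =
  trans (∑-++ (map (h x) ys) _ f) (cong₂ _+_ (∑-map (h x) ys f) (∑-cartesianProductWith h xs ys f))

length-cartesianProductWith : ∀ {C : Set} (h : A → B → C) (xs : List A) (ys : List B) →
  length (cartesianProductWith h xs ys) ≡ length xs * length ys
length-cartesianProductWith h []       ys = refl
length-cartesianProductWith h (x ∷ xs) ys =
  trans (length-++ (map (h x) ys)) (cong₂ _+_ (length-map (h x) ys) (length-cartesianProductWith h xs ys))

∈⇒≤∑ : ∀ {x : A} {xs} (f : A → ℕ) → x ∈ xs → f x ≤ ∑ xs f
∈⇒≤∑ f (here refl)            = m≤m+n _ _
∈⇒≤∑ {xs = y ∷ _} f (there x∈xs) = ≤-trans (∈⇒≤∑ f x∈xs) (m≤n+m _ (f y))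

∑-filter-≤ : ∀ {P : A → Set} (P? : Decidable P) (xs : List A) (f : A → ℕ) → ∑ (filter P? xs) f ≤ ∑ xs f
∑-filter-≤ P? []       f = z≤n
∑-filter-≤ P? (x ∷ xs) f with P? x
... | yes _ = +-monoʳ-≤ (f x) (∑-filter-≤ P? xs f)
... | no  _ = ≤-trans (∑-filter-≤ P? xs f) (m≤n+m _ (f x))

∑-length : ∀ (xs : List A) → (∑[ _ ∈ xs ] 1) ≡ length xs
∑-length xs = trans (∑-const xs 1) (*-identityʳ (length xs))

markov : ∀ c (xs : List A) (f : A → ℕ) → length (filter (λ x → c ≤? f x) xs) * c ≤ ∑ xs f
markov c xs f = begin
  length ys * c     ≡⟨ ∑-const ys c ⟨
  (∑[ _ ∈ ys ] c)   ≤⟨ ∑-mono-∈ ys (λ x∈ys → proj₂ (∈-filter⁻ (λ x → c ≤? f x) {xs = xs} x∈ys)) ⟩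
  ∑ ys f            ≤⟨ ∑-filter-≤ (λ x → c ≤? f x) xs f ⟩
  ∑ xs f            ∎
  where
  open ≤-Reasoning
  ys = filter (λ x → c ≤? f x) xs

averaging : ∀ (xs : List A) (f : A → ℕ) B → 0 < length xs → ∑ xs f ≤ length xs * B → ∃[ x ] f x ≤ B
averaging (x ∷ xs) f B _ total with f x ≤? B
... | yes fx≤B = x , fx≤B
... | no  fx≰B with xs
...   | []     = ⊥-elim (fx≰B (+-cancelʳ-≤ 0 _ _ total))
...   | y ∷ ys = averaging (y ∷ ys) f B (s≤s z≤n)
                   (+-cancelˡ-≤ B _ _ (≤-trans (+-monoˡ-≤ _ (<⇒≤ (≰⇒> fx≰B))) total))

-- Agreement and difference of bits, as numbers

⟦_⟧ : Bool → ℕ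
⟦ false ⟧ = 0
⟦ true  ⟧ = 1

⟦⟧≤1 : ∀ b → ⟦ b ⟧ ≤ 1
⟦⟧≤1 false = z≤n
⟦⟧≤1 true  = ≤-refl

agree differ : Bool → Bool → ℕ
agree  a b = ⟦ not (a xor b) ⟧
differ a b = ⟦ a xor b ⟧

agree+differ : ∀ a b → agree a b + differ a b ≡ 1
agree+differ false false = refl
agree+differ false true  = refl
agree+differ true  false = refl
agree+differ true  true  = refl

differ-refl : ∀ a → differ a a ≡ 0
differ-refl false = refl
differ-refl true  = refl

differ-triangle : ∀ a b c → differ a c ≤ differ b a + differ b c
differ-triangle false _     false = z≤n
differ-triangle false false true  = s≤s z≤n
differ-triangle false true  true  = s≤s z≤n
differ-triangle true  false false = s≤s z≤n
differ-triangle true  true  false = s≤s z≤n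
differ-triangle true  _     true  = z≤n

∑-agree+differ : ∀ (xs : List A) (f g : A → Bool) →
  (∑[ x ∈ xs ] agree (f x) (g x)) + (∑[ x ∈ xs ] differ (f x) (g x)) ≡ length xs
∑-agree+differ xs f g =
  trans (sym (∑-+ xs _ _)) (trans (∑-cong xs (λ x → agree+differ (f x) (g x))) (∑-length xs))

length-filter-differ : ∀ (f g : A → Bool) xs →
  length (filter (λ x → ¬? (f x ≟ g x)) xs) ≡ (∑[ x ∈ xs ] differ (f x) (g x))
length-filter-differ f g []       = refl
length-filter-differ f g (x ∷ xs) with f x | g x
... | false | false = length-filter-differ f g xs
... | false | true  = cong suc (length-filter-differ f g xs)
... | true  | false = cong suc (length-filter-differ f g xs)
... | true  | true  = length-filter-differ f g xs

length-filter-agree : ∀ (f : A → Bool) b xs →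
  length (filter (λ x → f x ≟ b) xs) ≡ (∑[ x ∈ xs ] agree (f x) b)
length-filter-agree f b []       = refl
length-filter-agree f b (x ∷ xs) with f x | b
... | false | false = cong suc (length-filter-agree f false xs)
... | false | true  = length-filter-agree f true xs
... | true  | false = length-filter-agree f false xs
... | true  | true  = cong suc (length-filter-agree f true xs)

-- Enumerations of points, vectors and functions

length-points : ∀ n → length (points n) ≡ 2 ^ n
length-points zero    = refl
length-points (suc n) =
  trans (length-++ (map (false ∷_) (points n)))
        (cong₂ _+_ (trans (length-map _ (points n)) (length-points n))
                   (trans (length-map _ (points n)) (trans (length-points n) (sym (+-identityʳ _)))))

∈-points : ∀ {n} (v : Point n) → v ∈ points n
∈-points []          = here refl
∈-points (false ∷ v) = ∈-++⁺ˡ (∈-map⁺ (false ∷_) (∈-points v))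
∈-points (true  ∷ v) = ∈-++⁺ʳ (map (false ∷_) (points _)) (∈-map⁺ (true ∷_) (∈-points v))

∑-points : ∀ n (f : Point (suc n) → ℕ) →
  ∑ (points (suc n)) f ≡ (∑[ v ∈ points n ] (f (false ∷ v) + f (true ∷ v)))
∑-points n f = trans (∑-++ (map (false ∷_) (points n)) _ f)
  (trans (cong₂ _+_ (∑-map _ (points n) f) (∑-map _ (points n) f)) (sym (∑-+ (points n) _ _)))

vectors : List A → ∀ n → List (Vec A n)
vectors xs zero    = [] ∷ []
vectors xs (suc n) = cartesianProductWith _∷_ xs (vectors xs n)

length-vectors : ∀ (xs : List A) n → length (vectors xs n) ≡ length xs ^ n
length-vectors xs zero    = refl
length-vectors xs (suc n) =
  trans (length-cartesianProductWith _∷_ xs (vectors xs n)) (cong (length xs *_) (length-vectors xs n))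

∈-vectors : ∀ {xs : List A} → (∀ x → x ∈ xs) → ∀ {n} (v : Vec A n) → v ∈ vectors xs n
∈-vectors total []      = here refl
∈-vectors total (x ∷ v) = ∈-cartesianProductWith⁺ _∷_ (total x) (∈-vectors total v)

glue : ∀ {n} → BoolFun n → BoolFun n → BoolFun (suc n)
glue f g (false ∷ v) = f v
glue f g (true  ∷ v) = g v

-- Splitting on the first bit makes `toggle p` act on only one half of a glued function, which
-- drives the induction in `∑-toggle`.
functions : ∀ n → List (BoolFun n)
functions zero    = (λ _ → false) ∷ (λ _ → true) ∷ []
functions (suc n) = cartesianProductWith glue (functions n) (functions n)

length-functions : ∀ n → length (functions n) ≡ 2 ^ (2 ^ n)
length-functions zero    = refl
length-functions (suc n) = begin
  length (functions (suc n))                     ≡⟨ length-cartesianProductWith glue (functions n) (functions n) ⟩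
  length (functions n) * length (functions n)    ≡⟨ cong₂ _*_ (length-functions n) (length-functions n) ⟩
  2 ^ (2 ^ n) * 2 ^ (2 ^ n)                      ≡⟨ ^-distribˡ-+-* 2 (2 ^ n) (2 ^ n) ⟨
  2 ^ (2 ^ n + 2 ^ n)                            ≡⟨ cong (λ e → 2 ^ (2 ^ n + e)) (+-identityʳ (2 ^ n)) ⟨
  2 ^ (2 ^ suc n)                                ∎
  where open ≡-Reasoning

represented : ∀ {n} (f : BoolFun n) → Σ[ f′ ∈ BoolFun n ] f′ ∈ functions n × f ≗ f′
represented {zero} f with f [] in f[]≡
... | false = (λ _ → false) , here refl , λ { [] → f[]≡ }
... | true  = (λ _ → true) , there (here refl) , λ { [] → f[]≡ }
represented {suc n} f with represented (f ∘ (false ∷_)) | represented (f ∘ (true ∷_))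
... | g , g∈ , f≗g | h , h∈ , f≗h =
  glue g h , ∈-cartesianProductWith⁺ glue g∈ h∈ , λ { (false ∷ v) → f≗g v ; (true ∷ v) → f≗h v }

-- Toggling a single value of a function

_≟ᵖ_ : ∀ {n} (u v : Point n) → Dec (u ≡ v)
_≟ᵖ_ = ≡-dec _≟_

toggle : ∀ {n} → Point n → BoolFun n → BoolFun n
toggle p f v with v ≟ᵖ p
... | yes _ = not (f v)
... | no  _ = f v

toggle-≡ : ∀ {n} (p : Point n) f → toggle p f p ≡ not (f p)
toggle-≡ p f with p ≟ᵖ p
... | yes _   = refl
... | no  p≢p = ⊥-elim (p≢p refl)

toggle-≢ : ∀ {n} (p v : Point n) f → v ≢ p → toggle p f v ≡ f v
toggle-≢ p v f v≢p with v ≟ᵖ p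
... | yes v≡p = ⊥-elim (v≢p v≡p)
... | no  _   = refl

-- A toggled function occurs in `functions n` only up to pointwise equality, so a sum can be
-- reindexed by `toggle p` when its summand respects that equality.
Extensional : ∀ {n} → (BoolFun n → ℕ) → Set
Extensional G = ∀ {f g} → f ≗ g → G f ≡ G g

glue-cong : ∀ {n} {f f′ g g′ : BoolFun n} → f ≗ f′ → g ≗ g′ → glue f g ≗ glue f′ g′
glue-cong f≗ g≗ (false ∷ v) = f≗ v
glue-cong f≗ g≗ (true  ∷ v) = g≗ v

∷-injective : ∀ {n b} {u v : Point n} → (b ∷ u) ≡ (b ∷ v) → u ≡ v
∷-injective refl = refl

toggle-glueˡ : ∀ {n} (p : Point n) f g → toggle (false ∷ p) (glue f g) ≗ glue (toggle p f) g
toggle-glueˡ p f g (true ∷ v) = toggle-≢ (false ∷ p) (true ∷ v) (glue f g) (λ ())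
toggle-glueˡ p f g (false ∷ v) = byCases (v ≟ᵖ p)
  where
  byCases : Dec (v ≡ p) → toggle (false ∷ p) (glue f g) (false ∷ v) ≡ toggle p f v
  byCases (yes refl) = trans (toggle-≡ (false ∷ p) (glue f g)) (sym (toggle-≡ p f))
  byCases (no  v≢p)  = trans (toggle-≢ (false ∷ p) (false ∷ v) (glue f g) (v≢p ∘ ∷-injective)) (sym (toggle-≢ p v f v≢p))

toggle-glueʳ : ∀ {n} (p : Point n) f g → toggle (true ∷ p) (glue f g) ≗ glue f (toggle p g)
toggle-glueʳ p f g (false ∷ v) = toggle-≢ (true ∷ p) (false ∷ v) (glue f g) (λ ())
toggle-glueʳ p f g (true ∷ v) = byCases (v ≟ᵖ p)
  where
  byCases : Dec (v ≡ p) → toggle (true ∷ p) (glue f g) (true ∷ v) ≡ toggle p g v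
  byCases (yes refl) = trans (toggle-≡ (true ∷ p) (glue f g)) (sym (toggle-≡ p g))
  byCases (no  v≢p)  = trans (toggle-≢ (true ∷ p) (true ∷ v) (glue f g) (v≢p ∘ ∷-injective)) (sym (toggle-≢ p v g v≢p))

∑-toggle : ∀ {n} (p : Point n) (G : BoolFun n → ℕ) → Extensional G →
  ∑ (functions n) (G ∘ toggle p) ≡ ∑ (functions n) G
∑-toggle {zero} [] G ext =
  trans (cong₂ (λ a b → a + (b + 0)) (ext (λ { [] → refl })) (ext (λ { [] → refl })))
        (swap (G (λ _ → true)) (G (λ _ → false)))
  where
  swap : ∀ a b → a + (b + 0) ≡ b + (a + 0)
  swap = solve-∀
∑-toggle {suc n} (false ∷ p) G ext = begin
  ∑ (functions (suc n)) (G ∘ toggle (false ∷ p))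
    ≡⟨ ∑-cartesianProductWith glue F F _ ⟩
  (∑[ f ∈ F ] ∑[ g ∈ F ] G (toggle (false ∷ p) (glue f g)))
    ≡⟨ ∑-cong F (λ f → ∑-cong F (λ g → ext (toggle-glueˡ p f g))) ⟩
  (∑[ f ∈ F ] ∑[ g ∈ F ] G (glue (toggle p f) g))
    ≡⟨ ∑-toggle p (λ f → ∑[ g ∈ F ] G (glue f g)) (λ f≗ → ∑-cong F (λ g → ext (glue-cong f≗ (λ _ → refl)))) ⟩
  (∑[ f ∈ F ] ∑[ g ∈ F ] G (glue f g))
    ≡⟨ ∑-cartesianProductWith glue F F _ ⟨
  ∑ (functions (suc n)) G ∎
  where
  open ≡-Reasoning
  F = functions n
∑-toggle {suc n} (true ∷ p) G ext = begin
  ∑ (functions (suc n)) (G ∘ toggle (true ∷ p))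
    ≡⟨ ∑-cartesianProductWith glue F F _ ⟩
  (∑[ f ∈ F ] ∑[ g ∈ F ] G (toggle (true ∷ p) (glue f g)))
    ≡⟨ ∑-cong F (λ f → ∑-cong F (λ g → ext (toggle-glueʳ p f g))) ⟩
  (∑[ f ∈ F ] ∑[ g ∈ F ] G (glue f (toggle p g)))
    ≡⟨ ∑-cong F (λ f → ∑-toggle p (G ∘ glue f) (λ g≗ → ext (glue-cong (λ _ → refl) g≗))) ⟩
  (∑[ f ∈ F ] ∑[ g ∈ F ] G (glue f g))
    ≡⟨ ∑-cartesianProductWith glue F F _ ⟨
  ∑ (functions (suc n)) G ∎
  where
  open ≡-Reasoning
  F = functions n

-- Agreements of a random core

agreements : ∀ {k} → BoolFun k → List (Point k × Point k) → ℕ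
agreements c ps = ∑[ p ∈ ps ] agree (c (proj₁ p)) (c (proj₂ p))

agreements-cong : ∀ {k} (ps : List (Point k × Point k)) → Extensional (λ c → agreements c ps)
agreements-cong ps f≗g = ∑-cong ps (λ p → cong₂ agree (f≗g (proj₁ p)) (f≗g (proj₂ p)))

-- Once a random core is fixed at all first points, its values at the second points are still
-- independent fair bits, and so are the agreements. First points may coincide with each other.
record Independent {k} (ps : List (Point k × Point k)) : Set where
  field
    disjoint : ∀ {p p′} → p ∈ ps → p′ ∈ ps → proj₁ p ≢ proj₂ p′
    distinct : AllPairs (λ p p′ → proj₂ p ≢ proj₂ p′) ps
open Independent

-- Each agreement contributes a factor of mean 5/2 to the moment. This is less than 4^(3/4), so a
-- proportion 3/4 of agreements is exponentially unlikely.
4^agree+4^agree-not : ∀ a b → 4 ^ agree a b + 4 ^ agree a (not b) ≡ 5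
4^agree+4^agree-not false false = refl
4^agree+4^agree-not false true  = refl
4^agree+4^agree-not true  false = refl
4^agree+4^agree-not true  true  = refl

-- The second points are fresh, so toggling c at one of them resamples a single agreement.
exponentialMoment : ∀ {k} {ps : List (Point k × Point k)} → Independent ps →
  2 ^ length ps * (∑[ c ∈ functions k ] 4 ^ agreements c ps) ≡ 5 ^ length ps * length (functions k)
exponentialMoment {k} {[]} _ = cong (_+ 0) (∑-length (functions k))
exponentialMoment {k} {(d , e) ∷ ps} record { disjoint = disj ; distinct = e∉ ∷ dist } = begin
  2 * 2 ^ n * ∑ F HG         ≡⟨ rearrange₁ (2 ^ n) (∑ F HG) ⟩
  2 ^ n * (∑ F HG + ∑ F HG)  ≡⟨ cong (λ s → 2 ^ n * (s + ∑ F HG)) (∑-toggle e HG HG-ext) ⟨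
  2 ^ n * (∑ F (HG ∘ toggle e) + ∑ F HG) ≡⟨ cong (2 ^ n *_) (∑-+ F _ _) ⟨
  2 ^ n * ∑ F (λ c → HG (toggle e c) + HG c) ≡⟨ cong (2 ^ n *_) (trans (∑-cong F resample) (∑-* F 5 G)) ⟩
  2 ^ n * (5 * ∑ F G)        ≡⟨ rearrange₂ (2 ^ n) (∑ F G) ⟩
  5 * (2 ^ n * ∑ F G)        ≡⟨ cong (5 *_) (exponentialMoment independent) ⟩
  5 * (5 ^ n * length F)     ≡⟨ *-assoc 5 (5 ^ n) (length F) ⟨
  5 * 5 ^ n * length F       ∎
  where
  open ≡-Reasoning
  n = length ps
  F = functions k

  G HG : BoolFun k → ℕ
  G  c = 4 ^ agreements c ps
  HG c = 4 ^ agreements c ((d , e) ∷ ps)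

  HG-ext : Extensional HG
  HG-ext f≗g = cong (4 ^_) (agreements-cong ((d , e) ∷ ps) f≗g)

  independent : Independent ps
  independent = record { disjoint = λ p∈ p′∈ → disj (there p∈) (there p′∈) ; distinct = dist }

  G-toggle : ∀ c → agreements (toggle e c) ps ≡ agreements c ps
  G-toggle c = ∑-cong-∈ ps (λ {p} p∈ → cong₂ agree
    (toggle-≢ e (proj₁ p) c (disj (there p∈) (here refl)))
    (toggle-≢ e (proj₂ p) c (All.lookup e∉ p∈ ∘ sym)))

  resample : ∀ c → HG (toggle e c) + HG c ≡ 5 * G c
  resample c = begin
    HG (toggle e c) + HG c
      ≡⟨ cong (λ m → 4 ^ m + HG c) (cong₂ _+_ (cong₂ agree (toggle-≢ e d c (disj (here refl) (here refl))) (toggle-≡ e c)) (G-toggle c)) ⟩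
    4 ^ (agree (c d) (not (c e)) + agreements c ps) + HG c
      ≡⟨ cong₂ _+_ (^-distribˡ-+-* 4 (agree (c d) (not (c e))) _) (^-distribˡ-+-* 4 (agree (c d) (c e)) _) ⟩
    4 ^ agree (c d) (not (c e)) * G c + 4 ^ agree (c d) (c e) * G c
      ≡⟨ *-distribʳ-+ (G c) (4 ^ agree (c d) (not (c e))) _ ⟨
    (4 ^ agree (c d) (not (c e)) + 4 ^ agree (c d) (c e)) * G c
      ≡⟨ cong (_* G c) (trans (+-comm (4 ^ agree (c d) (not (c e))) _) (4^agree+4^agree-not (c d) (c e))) ⟩
    5 * G c ∎

  rearrange₁ : ∀ a b → 2 * a * b ≡ a * (b + b)
  rearrange₁ = solve-∀
  rearrange₂ : ∀ a b → a * (5 * b) ≡ 5 * (a * b)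
  rearrange₂ = solve-∀

-- Families of toggled functions and the readings of hypotheses

family : ∀ {ν} → List (Point ν) → BoolFun ν → List (BoolFun ν)
family []       z = z ∷ []
family (q ∷ qs) z = family qs z ++ family qs (toggle q z)

length-family : ∀ {ν} (qs : List (Point ν)) z → length (family qs z) ≡ 2 ^ length qs
length-family []       z = refl
length-family (q ∷ qs) z = trans (length-++ (family qs z))
  (cong₂ _+_ (length-family qs z) (trans (length-family qs (toggle q z)) (sym (+-identityʳ _))))

toggle-cong : ∀ {ν} (p : Point ν) {f g} → f ≗ g → toggle p f ≗ toggle p g
toggle-cong p f≗g v with v ≟ᵖ p
... | yes _ = cong not (f≗g v)
... | no  _ = f≗g v

∑-family-cong : ∀ {ν} (qs : List (Point ν)) {G : BoolFun ν → ℕ} → Extensional G →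
  Extensional (λ z → ∑ (family qs z) G)
∑-family-cong []       ext f≗g = cong (_+ 0) (ext f≗g)
∑-family-cong (q ∷ qs) {G} ext {f} {g} f≗g = begin
  ∑ (family qs f ++ family qs (toggle q f)) G              ≡⟨ ∑-++ (family qs f) _ G ⟩
  ∑ (family qs f) G + ∑ (family qs (toggle q f)) G         ≡⟨ cong₂ _+_ (∑-family-cong qs ext f≗g) (∑-family-cong qs ext (toggle-cong q f≗g)) ⟩
  ∑ (family qs g) G + ∑ (family qs (toggle q g)) G         ≡⟨ ∑-++ (family qs g) _ G ⟨
  ∑ (family qs g ++ family qs (toggle q g)) G              ∎
  where open ≡-Reasoning

-- Each member of a family arises from z by a fixed composition of toggles, which permutes all
-- functions. Hence a bound on the mean over every family is a bound on the mean over all z.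
∑-family : ∀ {ν} (qs : List (Point ν)) {G : BoolFun ν → ℕ} → Extensional G →
  (∑[ z ∈ functions ν ] ∑ (family qs z) G) ≡ 2 ^ length qs * ∑ (functions ν) G
∑-family {ν} []       {G} ext = trans (∑-cong (functions ν) (λ z → +-identityʳ (G z))) (sym (*-identityˡ _))
∑-family {ν} (q ∷ qs) {G} ext = begin
  (∑[ z ∈ F ] ∑ (family qs z ++ family qs (toggle q z)) G)
    ≡⟨ ∑-cong F (λ z → ∑-++ (family qs z) _ G) ⟩
  (∑[ z ∈ F ] (∑ (family qs z) G + ∑ (family qs (toggle q z)) G))
    ≡⟨ ∑-+ F _ _ ⟩
  (∑[ z ∈ F ] ∑ (family qs z) G) + (∑[ z ∈ F ] ∑ (family qs (toggle q z)) G)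
    ≡⟨ cong (_+_ S) (∑-toggle q (λ z → ∑ (family qs z) G) (∑-family-cong qs ext)) ⟩
  S + S
    ≡⟨ cong₂ _+_ (∑-family qs ext) (∑-family qs ext) ⟩
  2 ^ length qs * ∑ F G + 2 ^ length qs * ∑ F G
    ≡⟨ rearrange (2 ^ length qs) (∑ F G) ⟩
  2 * 2 ^ length qs * ∑ F G ∎
  where
  open ≡-Reasoning
  F = functions ν
  S = ∑[ z ∈ F ] ∑ (family qs z) G
  rearrange : ∀ a b → a * b + a * b ≡ 2 * a * b
  rearrange = solve-∀

family-fixes : ∀ {ν} (qs : List (Point ν)) {z z′ p} → z′ ∈ family qs z → p ∉ qs → z′ p ≡ z p
family-fixes []       (here refl) p∉ = refl
family-fixes (q ∷ qs) {z} {p = p} z′∈ p∉ with ∈-++⁻ (family qs z) z′∈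
... | inj₁ z′∈ˡ = family-fixes qs z′∈ˡ (p∉ ∘ there)
... | inj₂ z′∈ʳ = trans (family-fixes qs z′∈ʳ (p∉ ∘ there)) (toggle-≢ q p z (p∉ ∘ here))

-- An entry of a hypothesis is s ∷ p: a sign s and a position p at which z is read.
probe : ∀ {ν} → BoolFun ν → Point (suc ν) → Bool
probe z a = head a xor z (tail a)

reading : ∀ {ν k} → Vec (Point (suc ν)) k → BoolFun ν → Point k
reading η z = Vec.map (probe z) η

reading-≢ : ∀ {ν k} (η η′ : Vec (Point (suc ν)) k) z z′ i →
  probe z (lookup η i) ≢ probe z′ (lookup η′ i) → reading η z ≢ reading η′ z′
reading-≢ η η′ z z′ i probes≢ readings≡ = probes≢
  (trans (sym (lookup-map i (probe z) η)) (trans (cong (λ v → lookup v i) readings≡) (lookup-map i (probe z′) η′)))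

Spread : ∀ {ν k} → Vec (Point (suc ν)) k → Set
Spread η = ∀ {i j} → tail (lookup η i) ≡ tail (lookup η j) → i ≡ j

xor-cancelˡ : ∀ a {b c} → a xor b ≡ a xor c → b ≡ c
xor-cancelˡ false eq = eq
xor-cancelˡ true {false} {false} eq = refl
xor-cancelˡ true {true}  {true}  eq = refl

not-≢ : ∀ b → b ≢ not b
not-≢ false ()
not-≢ true ()

-- The two halves of the family of `q ∷ qs` have opposite values at `q`, which no toggle in `qs`
-- touches. Some coordinate of `η` reads `q`, so readings from different halves differ there.
family-distinct : ∀ {ν k} (η : Vec (Point (suc ν)) k) {qs} → Unique qs →
  (∀ {q} → q ∈ qs → ∃[ i ] q ≡ tail (lookup η i)) →
  ∀ z → AllPairs (λ f g → reading η f ≢ reading η g) (family qs z)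
family-distinct η []         _      z = [] ∷ []
family-distinct η {q ∷ qs} (q∉ ∷ u) probed z with probed (here refl)
... | i , refl = AllPairs.++⁺ (family-distinct η u (probed ∘ there) z) (family-distinct η u (probed ∘ there) (toggle q z))
  (All.tabulate (λ {f} f∈ → All.tabulate (λ {g} g∈ → reading-≢ η η f g i (λ eq → not-≢ (z q) (begin
    z q            ≡⟨ family-fixes qs f∈ q∉qs ⟨
    f q            ≡⟨ xor-cancelˡ (head (lookup η i)) eq ⟩
    g q            ≡⟨ family-fixes qs g∈ q∉qs ⟩
    toggle q z q   ≡⟨ toggle-≡ q z ⟩
    not (z q)      ∎)))))
  where
  open ≡-Reasoning
  q∉qs : q ∉ qs
  q∉qs q∈ = All.lookup q∉ q∈ refl

remove : ∀ {ν} → Point ν → List (Point ν) → List (Point ν)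
remove p = filter (λ q → ¬? (q ≟ᵖ p))

length-remove : ∀ {ν} (p : Point ν) {qs} → Unique qs → length qs ≤ suc (length (remove p qs))
length-remove p []       = z≤n
length-remove p {q ∷ qs} (q∉ ∷ u) with q ≟ᵖ p
... | yes refl = s≤s (≤-reflexive (sym (cong length (filter-all (λ q → ¬? (q ≟ᵖ p)) (All.map (_∘ sym) q∉)))))
... | no  _    = s≤s (length-remove p u)

-- Fix z such that the two hypotheses read different values in coordinate j.  Toggling z at
-- positions other than a and b keeps these two values, so no reading of η ever meets a
-- reading of η′, while toggling at the other positions of η′ makes its readings distinct.
module Flips {ν k} (η η′ : Vec (Point (suc ν)) k) (j : Fin k) where

  a = tail (lookup η j)
  b = tail (lookup η′ j)

  positions : List (Point ν)
  positions = List.tabulate (λ i → tail (lookup η′ i))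

  flips : List (Point ν)
  -- If the positions are distinct, at least k ∸ 2 of them survive both removals. Truncation makes
  -- the number exact, so that all such events have the same size.
  flips = take (k ∸ 2) (remove a (remove b positions))

  event : BoolFun ν → List (Point k × Point k)
  event z = map (λ z′ → reading η z′ , reading η′ z′) (family flips z)

  ∈-flips : ∀ {q} → q ∈ flips → q ≢ a × q ≢ b × ∃[ i ] q ≡ tail (lookup η′ i)
  ∈-flips = All.lookup (All.take⁺ (k ∸ 2) (All.tabulate (λ q∈ →
    let q∈′ , q≢a = ∈-filter⁻ (λ q → ¬? (q ≟ᵖ a)) {xs = remove b positions} q∈
        q∈″ , q≢b = ∈-filter⁻ (λ q → ¬? (q ≟ᵖ b)) {xs = positions} q∈′
    in q≢a , q≢b , ∈-tabulate⁻ q∈″)))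

  module _ (spread : Spread η′) where

    unique : Unique positions
    unique = Unique.tabulate⁺ spread

    length-flips : length flips ≡ k ∸ 2
    length-flips = trans (length-take (k ∸ 2) rest) (m≤n⇒m⊓n≡m (m≤n+o⇒m∸n≤o k 2 (begin
      k                                      ≡⟨ length-tabulate (λ i → tail (lookup η′ i)) ⟨
      length positions                       ≤⟨ length-remove b unique ⟩
      suc (length (remove b positions))      ≤⟨ s≤s (length-remove a (Unique.filter⁺ _ unique)) ⟩
      2 + length rest                        ∎)))
      where
      open ≤-Reasoning
      rest = remove a (remove b positions)

    length-event : ∀ z → length (event z) ≡ 2 ^ (k ∸ 2)
    length-event z = trans (length-map _ (family flips z)) (trans (length-family flips z) (cong (2 ^_) length-flips))

    event-independent : ∀ z → probe z (lookup η j) ≢ probe z (lookup η′ j) → Independent (event z)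
    event-independent z probes≢ = record
      { disjoint = λ p∈ p′∈ → disjoint′ (∈-map⁻ _ p∈) (∈-map⁻ _ p′∈)
      ; distinct = AllPairs.map⁺ (family-distinct η′ (Unique.take⁺ (k ∸ 2) (Unique.filter⁺ _ (Unique.filter⁺ _ unique)))
                                   (λ q∈ → proj₂ (proj₂ (∈-flips q∈))) z)
      }
      where
      disjoint′ : ∀ {p p′} →
        (∃[ f ] f ∈ family flips z × p ≡ (reading η f , reading η′ f)) →
        (∃[ g ] g ∈ family flips z × p′ ≡ (reading η g , reading η′ g)) → proj₁ p ≢ proj₂ p′
      disjoint′ (f , f∈ , refl) (g , g∈ , refl) = reading-≢ η η′ f g j (λ eq → probes≢ (begin
        probe z (lookup η j)   ≡⟨ cong (head (lookup η j) xor_) (family-fixes flips f∈ (λ a∈ → proj₁ (∈-flips a∈) refl)) ⟨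
        probe f (lookup η j)   ≡⟨ eq ⟩
        probe g (lookup η′ j)  ≡⟨ cong (head (lookup η′ j) xor_) (family-fixes flips g∈ (λ b∈ → proj₁ (proj₂ (∈-flips b∈)) refl)) ⟩
        probe z (lookup η′ j)  ∎))
        where open ≡-Reasoning

    -- Toggling z at `b` flips what `η′` reads in coordinate j and, as `a ≢ b`, leaves what `η`
    -- reads there unchanged. This pairs the z's with different probes with those with equal ones.
    half-differ : a ≢ b →
      2 * (∑[ z ∈ functions ν ] differ (probe z (lookup η j)) (probe z (lookup η′ j))) ≡ length (functions ν)
    half-differ a≢b = begin
      2 * ∑ F D                             ≡⟨ cong (_+_ (∑ F D)) (+-identityʳ (∑ F D)) ⟩
      ∑ F D + ∑ F D                         ≡⟨ cong (_+ ∑ F D) (∑-toggle b D D-cong) ⟨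
      ∑ F (D ∘ toggle b) + ∑ F D            ≡⟨ ∑-+ F _ _ ⟨
      (∑[ z ∈ F ] (D (toggle b z) + D z))   ≡⟨ ∑-cong F opposite ⟩
      (∑[ z ∈ F ] 1)                        ≡⟨ ∑-length F ⟩
      length F                              ∎
      where
      open ≡-Reasoning
      F = functions ν
      D : BoolFun ν → ℕ
      D z = differ (probe z (lookup η j)) (probe z (lookup η′ j))
      D-cong : Extensional D
      D-cong f≗g = cong₂ (λ u v → differ (head (lookup η j) xor u) (head (lookup η′ j) xor v)) (f≗g a) (f≗g b)
      xor-opposite : ∀ s u s′ v → differ (s xor u) (s′ xor not v) + differ (s xor u) (s′ xor v) ≡ 1
      xor-opposite false false false false = refl
      xor-opposite false false false true = refl
      xor-opposite false false true false = refl
      xor-opposite false false true true = refl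
      xor-opposite false true false false = refl
      xor-opposite false true false true = refl
      xor-opposite false true true false = refl
      xor-opposite false true true true = refl
      xor-opposite true false false false = refl
      xor-opposite true false false true = refl
      xor-opposite true false true false = refl
      xor-opposite true false true true = refl
      xor-opposite true true false false = refl
      xor-opposite true true false true = refl
      xor-opposite true true true false = refl
      xor-opposite true true true true = refl
      opposite : ∀ z → D (toggle b z) + D z ≡ 1
      opposite z = trans
        (cong₂ (λ u v → differ (head (lookup η j) xor u) (head (lookup η′ j) xor v) + D z) (toggle-≢ b a z a≢b) (toggle-≡ b z))
        (xor-opposite (head (lookup η j)) (z a) (head (lookup η′ j)) (z b))

    -- For half of the z's the probes at j differ, the event is independent and its agreement rate
    -- is at most 3/4. For the other half the trivial rate 1 is used, and the mean is 7/8.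
    separated : ∀ (c : BoolFun k) → a ≢ b →
      (∀ {z} → z ∈ functions ν → Independent (event z) → 4 * agreements c (event z) ≤ 3 * 2 ^ (k ∸ 2)) →
      8 * (∑[ z ∈ functions ν ] agree (c (reading η z)) (c (reading η′ z))) ≤ 7 * length (functions ν)
    separated c a≢b few = *-cancelˡ-≤ N {{m^n≢0 2 (k ∸ 2)}} (+-cancelʳ-≤ (N * L) _ _ (begin
      N * (8 * S) + N * L               ≡⟨ cong (λ l → N * (8 * S) + N * l) (half-differ a≢b) ⟨
      N * (8 * S) + N * (2 * ∑ F D)     ≡⟨ rearrange₁ N S (∑ F D) ⟩
      2 * (4 * (N * S) + N * ∑ F D)     ≡⟨ cong (λ s → 2 * (4 * s + N * ∑ F D)) total ⟨
      2 * (4 * (∑[ z ∈ F ] E z) + N * ∑ F D)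
                                        ≡⟨ cong₂ (λ s t → 2 * (s + t)) (∑-* F 4 E) (∑-* F N D) ⟨
      2 * ((∑[ z ∈ F ] (4 * E z)) + (∑[ z ∈ F ] (N * D z)))
                                        ≡⟨ cong (2 *_) (∑-+ F _ _) ⟨
      2 * (∑[ z ∈ F ] (4 * E z + N * D z))
                                        ≤⟨ *-monoʳ-≤ 2 (∑-mono-∈ F (λ {z} z∈ → pointwise z z∈ (probe z (lookup η j) ≟ probe z (lookup η′ j)))) ⟩
      2 * (∑[ z ∈ F ] (4 * N))          ≡⟨ cong (2 *_) (∑-const F (4 * N)) ⟩
      2 * (L * (4 * N))                 ≡⟨ rearrange₂ L N ⟩
      N * (7 * L) + N * L               ∎))
      where
      open ≤-Reasoning
      F = functions ν
      L = length F
      N = 2 ^ (k ∸ 2)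
      D G E : BoolFun ν → ℕ
      D z = differ (probe z (lookup η j)) (probe z (lookup η′ j))
      G z = agree (c (reading η z)) (c (reading η′ z))
      E z = agreements c (event z)
      S = ∑ F G

      reading-cong : ∀ (θ : Vec (Point (suc ν)) k) {f g} → f ≗ g → reading θ f ≡ reading θ g
      reading-cong θ f≗g = map-cong (λ p → cong (head p xor_) (f≗g (tail p))) θ

      total : ∑ F E ≡ N * S
      total = trans (∑-cong F (λ z → ∑-map _ (family flips z) _))
        (trans (∑-family flips {G} (λ f≗g → cong₂ (λ u v → agree (c u) (c v)) (reading-cong η f≗g) (reading-cong η′ f≗g)))
               (cong (λ m → 2 ^ m * S) length-flips))

      pointwise : ∀ z → z ∈ F → Dec (probe z (lookup η j) ≡ probe z (lookup η′ j)) → 4 * E z + N * D z ≤ 4 * N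
      pointwise z z∈ (yes eq) = begin
        4 * E z + N * D z  ≡⟨ cong (λ d → 4 * E z + N * d) (trans (cong (λ u → differ u (probe z (lookup η′ j))) eq) (differ-refl (probe z (lookup η′ j)))) ⟩
        4 * E z + N * 0    ≡⟨ trans (cong (_+_ (4 * E z)) (*-zeroʳ N)) (+-identityʳ _) ⟩
        4 * E z            ≤⟨ *-monoʳ-≤ 4 (m≤m+n (E z) _) ⟩
        4 * (E z + _)      ≡⟨ cong (4 *_) (trans (∑-agree+differ (event z) (c ∘ proj₁) (c ∘ proj₂)) (length-event z)) ⟩
        4 * N              ∎
      pointwise z z∈ (no neq) = begin
        4 * E z + N * D z  ≤⟨ +-mono-≤ (few z∈ (event-independent z neq)) (*-monoʳ-≤ N (⟦⟧≤1 _)) ⟩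
        3 * N + N * 1      ≡⟨ rearrange₃ N ⟩
        4 * N              ∎
        where
        rearrange₃ : ∀ n → 3 * n + n * 1 ≡ 4 * n
        rearrange₃ = solve-∀

      rearrange₁ : ∀ n s d → n * (8 * s) + n * (2 * d) ≡ 2 * (4 * (n * s) + n * d)
      rearrange₁ = solve-∀
      rearrange₂ : ∀ l n → 2 * (l * (4 * n)) ≡ n * (7 * l) + n * l
      rearrange₂ = solve-∀

-- Choosing the samples

2^⟦⟧ : ∀ b → 2 ^ ⟦ b ⟧ ≡ 1 + ⟦ b ⟧
2^⟦⟧ false = refl
2^⟦⟧ true  = refl

-- The method of conditional expectations: each sample is chosen so that the potential
-- Σ 2^(number of hits) grows at most by its average factor 15/8.
greedySamples : ∀ (xs : List A) (ps : List B) (hit : B → A → Bool) → 0 < length xs →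
  (∀ {p} → p ∈ ps → 8 * (∑[ x ∈ xs ] ⟦ hit p x ⟧) ≤ 7 * length xs) → ∀ T →
  Σ[ zs ∈ List A ] length zs ≡ T × 8 ^ T * (∑[ p ∈ ps ] 2 ^ (∑[ z ∈ zs ] ⟦ hit p z ⟧)) ≤ 15 ^ T * length ps
greedySamples xs ps hit xs≢[] rare zero    =
  [] , refl , ≤-reflexive (cong (_+ 0) (∑-length ps))
greedySamples {A} {B} xs ps hit xs≢[] rare (suc T) with greedySamples xs ps hit xs≢[] rare T
... | zs , refl , small = extend (averaging xs Φ (15 * ∑ ps W) xs≢[] average)
  where
  open ≤-Reasoning
  L = length xs
  W : B → ℕ
  W p = 2 ^ (∑[ z ∈ zs ] ⟦ hit p z ⟧)
  W⁺ : A → B → ℕ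
  W⁺ x p = 2 ^ (∑[ z ∈ x ∷ zs ] ⟦ hit p z ⟧)
  Φ : A → ℕ
  Φ x = 8 * ∑ ps (W⁺ x)

  rearrange₁ : ∀ l s w → 8 * (w * (l + s)) ≡ w * (8 * l + 8 * s)
  rearrange₁ = solve-∀
  rearrange₂ : ∀ l w → w * (8 * l + 7 * l) ≡ l * 15 * w
  rearrange₂ = solve-∀
  rearrange₃ : ∀ a b → 8 * a * b ≡ a * (8 * b)
  rearrange₃ = solve-∀
  rearrange₄ : ∀ a b → a * (15 * b) ≡ 15 * (a * b)
  rearrange₄ = solve-∀

  perPair : ∀ {p} → p ∈ ps → 8 * (∑[ x ∈ xs ] W⁺ x p) ≤ L * 15 * W p
  perPair {p} p∈ = begin
    8 * (∑[ x ∈ xs ] W⁺ x p)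
      ≡⟨ cong (8 *_) (∑-cong xs (λ x → trans (^-distribˡ-+-* 2 ⟦ hit p x ⟧ _) (trans (cong (_* W p) (2^⟦⟧ (hit p x))) (*-comm (suc _) (W p))))) ⟩
    8 * (∑[ x ∈ xs ] (W p * (1 + ⟦ hit p x ⟧)))
      ≡⟨ cong (8 *_) (trans (∑-* xs (W p) _) (cong (W p *_) (trans (∑-+ xs _ _) (cong (_+ (∑[ x ∈ xs ] ⟦ hit p x ⟧)) (∑-length xs))))) ⟩
    8 * (W p * (L + (∑[ x ∈ xs ] ⟦ hit p x ⟧)))
      ≡⟨ rearrange₁ L _ (W p) ⟩
    W p * (8 * L + 8 * (∑[ x ∈ xs ] ⟦ hit p x ⟧))
      ≤⟨ *-monoʳ-≤ (W p) (+-monoʳ-≤ (8 * L) (rare p∈)) ⟩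
    W p * (8 * L + 7 * L)
      ≡⟨ rearrange₂ L (W p) ⟩
    L * 15 * W p ∎

  average : ∑ xs Φ ≤ L * (15 * ∑ ps W)
  average = begin
    (∑[ x ∈ xs ] (8 * ∑ ps (W⁺ x)))         ≡⟨ ∑-* xs 8 _ ⟩
    8 * (∑[ x ∈ xs ] ∑[ p ∈ ps ] W⁺ x p)    ≡⟨ cong (8 *_) (∑-swap xs ps W⁺) ⟩
    8 * (∑[ p ∈ ps ] ∑[ x ∈ xs ] W⁺ x p)    ≡⟨ ∑-* ps 8 _ ⟨
    (∑[ p ∈ ps ] (8 * (∑[ x ∈ xs ] W⁺ x p))) ≤⟨ ∑-mono-∈ ps perPair ⟩
    (∑[ p ∈ ps ] (L * 15 * W p))            ≡⟨ ∑-* ps (L * 15) W ⟩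
    L * 15 * ∑ ps W                         ≡⟨ *-assoc L 15 _ ⟩
    L * (15 * ∑ ps W)                       ∎

  extend : (∃[ x ] Φ x ≤ 15 * ∑ ps W) →
    Σ[ zs′ ∈ List A ] length zs′ ≡ suc T × 8 ^ suc T * (∑[ p ∈ ps ] 2 ^ (∑[ z ∈ zs′ ] ⟦ hit p z ⟧)) ≤ 15 ^ suc T * length ps
  extend (x , Φx≤) = x ∷ zs , refl , (begin
    8 * 8 ^ T * ∑ ps (W⁺ x)      ≡⟨ rearrange₃ (8 ^ T) _ ⟩
    8 ^ T * Φ x                  ≤⟨ *-monoʳ-≤ (8 ^ T) Φx≤ ⟩
    8 ^ T * (15 * ∑ ps W)        ≡⟨ rearrange₄ (8 ^ T) _ ⟩
    15 * (8 ^ T * ∑ ps W)        ≤⟨ *-monoʳ-≤ 15 small ⟩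
    15 * (15 ^ T * length ps)    ≡⟨ *-assoc 15 (15 ^ T) _ ⟨
    15 * 15 ^ T * length ps      ∎)

^-reflects-≤ : ∀ {m n} → 2 ^ m ≤ 2 ^ n → m ≤ n
^-reflects-≤ {m} {n} le = ≮⇒≥ (λ n<m → <⇒≱ (^-monoʳ-< 2 (s≤s (s≤s z≤n)) n<m) le)

-- Since 8^48 = 2^144 and 15^48 ≤ 2^188, the potential after 48ℓ samples is at most 2^((188 - 144 +
-- 1)ℓ) = 2^(45ℓ), and it bounds 2^(hits) for every single pair. The condition on the hit rate is
-- decidable, so `ps` may list all pairs and the greedy choice is run on those that satisfy it.
samples : ∀ (xs : List A) (ps : List B) (hit : B → A → Bool) ℓ → 0 < length xs → length ps ≤ 2 ^ ℓ →
  Σ[ zs ∈ List A ] length zs ≡ 48 * ℓ ×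
    (∀ {p} → p ∈ ps → 8 * (∑[ x ∈ xs ] ⟦ hit p x ⟧) ≤ 7 * length xs → (∑[ z ∈ zs ] ⟦ hit p z ⟧) ≤ 45 * ℓ)
samples {A} {B} xs ps hit ℓ xs≢[] few = bound (greedySamples xs rare hit xs≢[] (λ p∈ → proj₂ (∈-filter⁻ rare? {xs = ps} p∈)) (48 * ℓ))
  where
  open ≤-Reasoning
  rare? : Decidable (λ p → 8 * (∑[ x ∈ xs ] ⟦ hit p x ⟧) ≤ 7 * length xs)
  rare? p = 8 * (∑[ x ∈ xs ] ⟦ hit p x ⟧) ≤? 7 * length xs
  rare = filter rare? ps

  15^48≤2^188 : 15 ^ 48 ≤ 2 ^ 188
  15^48≤2^188 = ≤ᵇ⇒≤ (15 ^ 48) (2 ^ 188) _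

  exponents : ∀ e → 144 * ℓ + e ≤ 188 * ℓ + ℓ → e ≤ 45 * ℓ
  exponents e le = +-cancelˡ-≤ (144 * ℓ) _ _ (≤-trans le (≤-reflexive (split ℓ)))
    where
    split : ∀ l → 188 * l + l ≡ 144 * l + 45 * l
    split = solve-∀

  bound : (Σ[ zs ∈ List A ] length zs ≡ 48 * ℓ ×
             8 ^ (48 * ℓ) * (∑[ p ∈ rare ] 2 ^ (∑[ z ∈ zs ] ⟦ hit p z ⟧)) ≤ 15 ^ (48 * ℓ) * length rare) → _
  bound (zs , length≡ , small) = zs , length≡ , λ {p} p∈ p-rare → let h = ∑[ z ∈ zs ] ⟦ hit p z ⟧ in
    exponents h (^-reflects-≤ (begin
      2 ^ (144 * ℓ + h)                 ≡⟨ ^-distribˡ-+-* 2 (144 * ℓ) h ⟩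
      2 ^ (144 * ℓ) * 2 ^ h             ≡⟨ cong (λ e → 2 ^ e * 2 ^ h) (*-assoc 3 48 ℓ) ⟩
      2 ^ (3 * (48 * ℓ)) * 2 ^ h        ≡⟨ cong (_* 2 ^ h) (^-*-assoc 2 3 (48 * ℓ)) ⟨
      8 ^ (48 * ℓ) * 2 ^ h              ≤⟨ *-monoʳ-≤ (8 ^ (48 * ℓ)) (∈⇒≤∑ (λ p → 2 ^ (∑[ z ∈ zs ] ⟦ hit p z ⟧)) (∈-filter⁺ rare? p∈ p-rare)) ⟩
      8 ^ (48 * ℓ) * _                  ≤⟨ small ⟩
      15 ^ (48 * ℓ) * length rare       ≤⟨ *-monoʳ-≤ (15 ^ (48 * ℓ)) (≤-trans (length-filter rare? ps) few) ⟩
      15 ^ (48 * ℓ) * 2 ^ ℓ             ≡⟨ cong (_* 2 ^ ℓ) (^-*-assoc 15 48 ℓ) ⟨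
      (15 ^ 48) ^ ℓ * 2 ^ ℓ             ≤⟨ *-monoˡ-≤ (2 ^ ℓ) (^-monoˡ-≤ ℓ 15^48≤2^188) ⟩
      (2 ^ 188) ^ ℓ * 2 ^ ℓ             ≡⟨ cong (_* 2 ^ ℓ) (^-*-assoc 2 188 ℓ) ⟩
      2 ^ (188 * ℓ) * 2 ^ ℓ             ≡⟨ ^-distribˡ-+-* 2 (188 * ℓ) ℓ ⟨
      2 ^ (188 * ℓ + ℓ)                 ∎))

-- Most cores separate the hypotheses

hypotheses : ∀ ν k → List (Vec (Point (suc ν)) k)
hypotheses ν k = vectors (points (suc ν)) k

length-hypotheses : ∀ ν k → length (hypotheses ν k) ≡ 2 ^ (suc ν * k)
length-hypotheses ν k = trans (length-vectors (points (suc ν)) k)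
  (trans (cong (_^ k) (length-points (suc ν))) (^-*-assoc 2 (suc ν) k))

∈-hypotheses : ∀ {ν k} (η : Vec (Point (suc ν)) k) → η ∈ hypotheses ν k
∈-hypotheses = ∈-vectors ∈-points

-- The asymmetry matches the decoder: `η′` will be the true hypothesis, spread unless cells collide,
-- and `η` any competitor.
Separating : ∀ {k} → ℕ → BoolFun k → Set
Separating {k} ν c = ∀ (η η′ : Vec (Point (suc ν)) k) j → Spread η′ → tail (lookup η j) ≢ tail (lookup η′ j) →
  8 * (∑[ z ∈ functions ν ] agree (c (reading η z)) (c (reading η′ z))) ≤ 7 * length (functions ν)

module RandomCore (κ ν : ℕ) where
  open ≤-Reasoning

  -- With k = 5 + κ an event has 2^(k-2) = 8m pairs. The factor 8 allows the numerical bound 5^8 ≤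
  -- 2^19 to be raised to the power m.
  k = 5 + κ
  m = 2 ^ κ

  Index : Set
  Index = (Vec (Point (suc ν)) k × Vec (Point (suc ν)) k) × (Fin k × BoolFun ν)

  indices : List Index
  indices = cartesianProduct (cartesianProduct (hypotheses ν k) (hypotheses ν k))
                             (cartesianProduct (allFin k) (functions ν))

  length-indices : length indices ≡ (2 ^ (suc ν * k) * 2 ^ (suc ν * k)) * (k * 2 ^ (2 ^ ν))
  length-indices = trans (length-cartesianProductWith _,_ (cartesianProduct (hypotheses ν k) (hypotheses ν k)) _) (cong₂ _*_
    (trans (length-cartesianProductWith _,_ (hypotheses ν k) _) (cong₂ _*_ (length-hypotheses ν k) (length-hypotheses ν k)))
    (trans (length-cartesianProductWith _,_ (allFin k) (functions ν)) (cong₂ _*_ (length-tabulate {n = k} id) (length-functions ν))))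

  eventOf : Index → List (Point k × Point k)
  eventOf ((η , η′) , (j , z)) = Flips.event η η′ j z

  moment : Index → ℕ
  moment i = ∑[ c ∈ functions k ] 4 ^ agreements c (eventOf i)

  -- The conclusion of exponentialMoment: a decidable substitute for independence of the event.
  Typical : Index → Set
  Typical i = 2 ^ (8 * m) * moment i ≤ 5 ^ (8 * m) * length (functions k)

  typical? : Decidable Typical
  typical? i = 2 ^ (8 * m) * moment i ≤? 5 ^ (8 * m) * length (functions k)

  typical : List Index
  typical = filter typical? indices

  -- A single sum takes care of the union bound: if it is below 4^(6m), then so is every summand,
  -- and each typical event has fewer than 6m agreements.
  potential : BoolFun k → ℕ
  potential c = ∑[ i ∈ typical ] 4 ^ agreements c (eventOf i)

  potential-cong : Extensional potential
  potential-cong f≗g = ∑-cong typical (λ i → cong (4 ^_) (agreements-cong (eventOf i) f≗g))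

  bad : List (BoolFun k)
  bad = filter (λ c → 4 ^ (6 * m) ≤? potential c) (functions k)

  -- The mean of each summand is at most (5/2)^(8m) ≤ 2^(11m), whereas the threshold is 4^(6m) =
  -- 2^(12m). By Markov's inequality each event spoils at most a fraction 2^(-m) of the cores.
  bad-rare : length bad * 2 ^ m ≤ length indices * 2 ^ (2 ^ k)
  bad-rare = *-cancelʳ-≤ _ _ (2 ^ (19 * m)) {{m^n≢0 2 (19 * m)}} (begin
    length bad * 2 ^ m * 2 ^ (19 * m)
      ≡⟨ rearrange₁ (length bad) ⟩
    2 ^ (8 * m) * (length bad * 4 ^ (6 * m))
      ≤⟨ *-monoʳ-≤ (2 ^ (8 * m)) (markov (4 ^ (6 * m)) F potential) ⟩
    2 ^ (8 * m) * ∑ F potential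
      ≡⟨ cong (2 ^ (8 * m) *_) (∑-swap F typical (λ c i → 4 ^ agreements c (eventOf i))) ⟩
    2 ^ (8 * m) * ∑ typical moment
      ≡⟨ ∑-* typical (2 ^ (8 * m)) moment ⟨
    (∑[ i ∈ typical ] (2 ^ (8 * m) * moment i))
      ≤⟨ ∑-mono-∈ typical (λ i∈ → proj₂ (∈-filter⁻ typical? {xs = indices} i∈)) ⟩
    (∑[ _ ∈ typical ] (5 ^ (8 * m) * length F))
      ≡⟨ ∑-const typical _ ⟩
    length typical * (5 ^ (8 * m) * length F)
      ≤⟨ *-mono-≤ (length-filter typical? indices) (*-mono-≤ 5^≤2^ (≤-reflexive (length-functions k))) ⟩
    length indices * (2 ^ (19 * m) * 2 ^ (2 ^ k))
      ≡⟨ rearrange₂ (length indices) (2 ^ (19 * m)) (2 ^ (2 ^ k)) ⟩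
    length indices * 2 ^ (2 ^ k) * 2 ^ (19 * m) ∎)
    where
    F = functions k

    5^≤2^ : 5 ^ (8 * m) ≤ 2 ^ (19 * m)
    5^≤2^ = begin
      5 ^ (8 * m)    ≡⟨ ^-*-assoc 5 8 m ⟨
      (5 ^ 8) ^ m    ≤⟨ ^-monoˡ-≤ m (≤ᵇ⇒≤ (5 ^ 8) (2 ^ 19) _) ⟩
      (2 ^ 19) ^ m   ≡⟨ ^-*-assoc 2 19 m ⟩
      2 ^ (19 * m)   ∎

    exponents : ∀ e → e + 19 * e ≡ 8 * e + 2 * (6 * e)
    exponents = solve-∀

    rearrange₁ : ∀ b → b * 2 ^ m * 2 ^ (19 * m) ≡ 2 ^ (8 * m) * (b * 4 ^ (6 * m))
    rearrange₁ b = begin-equality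
      b * 2 ^ m * 2 ^ (19 * m)                ≡⟨ *-assoc b _ _ ⟩
      b * (2 ^ m * 2 ^ (19 * m))              ≡⟨ cong (b *_) (^-distribˡ-+-* 2 m (19 * m)) ⟨
      b * 2 ^ (m + 19 * m)                    ≡⟨ cong (λ e → b * 2 ^ e) (exponents m) ⟩
      b * 2 ^ (8 * m + 2 * (6 * m))           ≡⟨ cong (b *_) (^-distribˡ-+-* 2 (8 * m) (2 * (6 * m))) ⟩
      b * (2 ^ (8 * m) * 2 ^ (2 * (6 * m)))   ≡⟨ cong (λ e → b * (2 ^ (8 * m) * e)) (^-*-assoc 2 2 (6 * m)) ⟨
      b * (2 ^ (8 * m) * 4 ^ (6 * m))         ≡⟨ swap b (2 ^ (8 * m)) (4 ^ (6 * m)) ⟩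
      2 ^ (8 * m) * (b * 4 ^ (6 * m))         ∎
      where
      swap : ∀ x y z → x * (y * z) ≡ y * (x * z)
      swap = solve-∀

    rearrange₂ : ∀ x y z → x * (y * z) ≡ x * z * y
    rearrange₂ = solve-∀

  separating : ∀ {c} → potential c < 4 ^ (6 * m) → Separating ν c
  separating {c} low η η′ j spread a≢b = Flips.separated η η′ j spread c a≢b few
    where
    few : ∀ {z} → z ∈ functions ν → Independent (Flips.event η η′ j z) →
      4 * agreements c (Flips.event η η′ j z) ≤ 3 * 2 ^ (3 + κ)
    few {z} z∈ independent = begin
      4 * agreements c (eventOf i)   ≤⟨ *-monoʳ-≤ 4 (<⇒≤ agreements<) ⟩
      4 * (6 * m)                    ≡⟨ regroup m ⟩
      3 * (8 * m)                    ≡⟨ cong (3 *_) (^-distribˡ-+-* 2 3 κ) ⟨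
      3 * 2 ^ (3 + κ)                ∎
      where
      i : Index
      i = ((η , η′) , (j , z))

      regroup : ∀ x → 4 * (6 * x) ≡ 3 * (8 * x)
      regroup = solve-∀

      i-typical : Typical i
      i-typical = ≤-reflexive (subst (λ l → 2 ^ l * moment i ≡ 5 ^ l * length (functions k))
        (trans (Flips.length-event η η′ j spread z) (^-distribˡ-+-* 2 3 κ)) (exponentialMoment independent))

      i∈ : i ∈ typical
      i∈ = ∈-filter⁺ typical? (∈-cartesianProduct⁺ (∈-cartesianProduct⁺ (∈-hypotheses η) (∈-hypotheses η′))
             (∈-cartesianProduct⁺ (∈-allFin j) z∈)) i-typical

      agreements< : agreements c (eventOf i) < 6 * m
      agreements< = ≰⇒> (λ le → <⇒≱ low (≤-trans (^-monoʳ-≤ 4 le) (∈⇒≤∑ (λ i → 4 ^ agreements c (eventOf i)) i∈)))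

-- Distribution of the queries over the seeds

same : ∀ {n} → Point n → Point n → Bool
same []      []      = true
same (a ∷ p) (b ∷ q) = not (a xor b) ∧ same p q

same-refl : ∀ {n} (p : Point n) → same p p ≡ true
same-refl []          = refl
same-refl (false ∷ p) = same-refl p
same-refl (true ∷ p)  = same-refl p

same-comm : ∀ {n} (p q : Point n) → same p q ≡ same q p
same-comm []      []      = refl
same-comm (a ∷ p) (b ∷ q) = cong₂ (λ u v → not u ∧ v) (xor-comm a b) (same-comm p q)

∑-same : ∀ n (q : Point n) → (∑[ p ∈ points n ] ⟦ same p q ⟧) ≡ 1
∑-same zero    []          = refl
∑-same (suc n) (false ∷ q) =
  trans (∑-points n _) (trans (∑-cong (points n) (λ p → +-identityʳ _)) (∑-same n q))
∑-same (suc n) (true ∷ q)  = trans (∑-points n _) (∑-same n q)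

-- The sign in front of the cell is free, which accounts for the value 2.
∑-same-tail : ∀ μ (q : Point μ) → (∑[ a ∈ points (suc μ) ] ⟦ same (tail a) q ⟧) ≡ 2
∑-same-tail μ q = trans (∑-points μ _) (trans (∑-+ (points μ) _ _) (cong₂ _+_ (∑-same μ q) (∑-same μ q)))

-- Common leading coordinates only multiply both sides. Once one of the two coordinates is the
-- first, its cell is uniform and independent of the other one.
∑-collision : ∀ μ {n} {i j : Fin n} → i ≢ j →
  2 ^ μ * (∑[ r ∈ vectors (points (suc μ)) n ] ⟦ same (tail (lookup r i)) (tail (lookup r j)) ⟧)
    ≡ length (vectors (points (suc μ)) n)
∑-collision μ {suc n} {i} {j} i≢j = trans (cong (2 ^ μ *_) (∑-cartesianProductWith _∷_ P V _))
  (trans (byCases i j i≢j) (sym (length-cartesianProductWith _∷_ P V)))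
  where
  open ≡-Reasoning
  P = points (suc μ)
  V = vectors P n

  regroup : ∀ a b → a * (b * 2) ≡ 2 * a * b
  regroup = solve-∀

  pairwise : (t : Fin n) → 2 ^ μ * (∑[ a ∈ P ] ∑[ r ∈ V ] ⟦ same (tail a) (tail (lookup r t)) ⟧) ≡ length P * length V
  pairwise t = begin
    2 ^ μ * (∑[ a ∈ P ] ∑[ r ∈ V ] ⟦ same (tail a) (tail (lookup r t)) ⟧)
      ≡⟨ cong (2 ^ μ *_) (trans (∑-swap P V (λ a r → ⟦ same (tail a) (tail (lookup r t)) ⟧)) (∑-cong V (λ r → ∑-same-tail μ (tail (lookup r t))))) ⟩
    2 ^ μ * (∑[ _ ∈ V ] 2)     ≡⟨ cong (2 ^ μ *_) (∑-const V 2) ⟩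
    2 ^ μ * (length V * 2)     ≡⟨ regroup (2 ^ μ) (length V) ⟩
    2 ^ suc μ * length V       ≡⟨ cong (_* length V) (length-points (suc μ)) ⟨
    length P * length V        ∎

  byCases : ∀ (i j : Fin (suc n)) → i ≢ j →
    2 ^ μ * (∑[ a ∈ P ] ∑[ r ∈ V ] ⟦ same (tail (lookup (a ∷ r) i)) (tail (lookup (a ∷ r) j)) ⟧) ≡ length P * length V
  byCases Fin.zero    Fin.zero    i≢j = ⊥-elim (i≢j refl)
  byCases Fin.zero    (Fin.suc j) i≢j = pairwise j
  byCases (Fin.suc i) Fin.zero    i≢j =
    trans (cong (2 ^ μ *_) (∑-cong P (λ a → ∑-cong V (λ r → cong ⟦_⟧ (same-comm (tail (lookup r i)) (tail a)))))) (pairwise i)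
  byCases (Fin.suc i) (Fin.suc j) i≢j = begin
    2 ^ μ * (∑[ _ ∈ P ] S)     ≡⟨ cong (2 ^ μ *_) (∑-const P S) ⟩
    2 ^ μ * (length P * S)     ≡⟨ swap (2 ^ μ) (length P) S ⟩
    length P * (2 ^ μ * S)     ≡⟨ cong (length P *_) (∑-collision μ (i≢j ∘ cong Fin.suc)) ⟩
    length P * length V        ∎
    where
    S = ∑[ r ∈ V ] ⟦ same (tail (lookup r i)) (tail (lookup r j)) ⟧
    swap : ∀ x y z → x * (y * z) ≡ y * (x * z)
    swap = solve-∀

query : ∀ {μ n} → Vec (Point (suc μ)) n → Point n → BoolFun (suc μ) → Point n
query r x z = zipWith (λ b a → head a xor z (b ∷ tail a)) x r

-- Whatever bit z supplies, the two signs produce both values of the coordinate. So each choice of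
-- cells accounts for every point exactly once, and there are (2^μ)^n such choices.
∑-query : ∀ μ {n} (x : Point n) (z : BoolFun (suc μ)) (G : Point n → ℕ) →
  (∑[ r ∈ vectors (points (suc μ)) n ] G (query r x z)) ≡ (2 ^ μ) ^ n * ∑ (points n) G
∑-query μ []              z G = sym (+-identityʳ (G [] + 0))
∑-query μ {suc n} (b ∷ x) z G = begin
  (∑[ r ∈ vectors P (suc n) ] G (query r (b ∷ x) z))
    ≡⟨ ∑-cartesianProductWith _∷_ P (vectors P n) _ ⟩
  (∑[ a ∈ P ] ∑[ r ∈ vectors P n ] G ((head a xor z (b ∷ tail a)) ∷ query r x z))
    ≡⟨ ∑-cong P (λ a → ∑-query μ x z (λ y → G ((head a xor z (b ∷ tail a)) ∷ y))) ⟩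
  (∑[ a ∈ P ] (M * H (head a xor z (b ∷ tail a))))
    ≡⟨ ∑-* P M _ ⟩
  M * (∑[ a ∈ P ] H (head a xor z (b ∷ tail a)))
    ≡⟨ cong (M *_) (trans (∑-points μ _) (∑-cong (points μ) (λ p → balanced (z (b ∷ p))))) ⟩
  M * (∑[ _ ∈ points μ ] (H false + H true))
    ≡⟨ cong (M *_) (trans (∑-const (points μ) _) (cong₂ _*_ (length-points μ) (trans (sym (∑-+ (points n) _ _)) (sym (∑-points n G))))) ⟩
  M * (2 ^ μ * ∑ (points (suc n)) G)
    ≡⟨ regroup M (2 ^ μ) _ ⟩
  2 ^ μ * M * ∑ (points (suc n)) G ∎
  where
  open ≡-Reasoning
  P = points (suc μ)
  M = (2 ^ μ) ^ n
  H : Bool → ℕ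
  H u = ∑[ y ∈ points n ] G (u ∷ y)
  balanced : ∀ u → H u + H (not u) ≡ H false + H true
  balanced false = refl
  balanced true  = +-comm (H true) (H false)
  regroup : ∀ a b c → a * (b * c) ≡ b * a * c
  regroup = solve-∀

-- The correction algorithm

∑-zip-map : ∀ (f : A × B → ℕ) (h : A → B) zs → ∑ (List.zip zs (map h zs)) f ≡ (∑[ z ∈ zs ] f (z , h z))
∑-zip-map f h []       = refl
∑-zip-map f h (z ∷ zs) = cong (_+_ (f (z , h z))) (∑-zip-map f h zs)

-- The algorithm's seeds are indices into a list of vectors; this turns counts over indices into
-- sums over the list.
∑-allFin-lookup : ∀ (xs : List A) (f : A → ℕ) → ∑ (allFin (length xs)) (f ∘ List.lookup xs) ≡ ∑ xs f
∑-allFin-lookup xs f = trans (sym (∑-map (List.lookup xs) (allFin (length xs)) f))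
  (cong (λ ys → ∑ ys f) (trans (map-tabulate id (List.lookup xs)) (tabulate-lookup xs)))

/-≤ : ∀ a b c d .{{_ : NonZero b}} .{{_ : NonZero d}} → a * d ≤ c * b → + a / b ≤ᵘ + c / d
/-≤ a (suc b) c (suc d) le = *≤* (subst₂ ℤ._≤_ (ℤ.pos-* a (suc d)) (ℤ.pos-* c (suc b)) (ℤ.+≤+ le))

/-≤⁻¹ : ∀ a b c d .{{_ : NonZero b}} .{{_ : NonZero d}} → + a / b ≤ᵘ + c / d → a * d ≤ c * b
/-≤⁻¹ a (suc b) c (suc d) (*≤* le) = ℤ.drop‿+≤+ (subst₂ ℤ._≤_ (sym (ℤ.pos-* a (suc d))) (sym (ℤ.pos-* c (suc b))) le)

var-injective : ∀ {n k} (J : JuntaVariables n k) {i j} → var J i ≡ var J j → i ≡ j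
var-injective J {i} {j} eq with Fin.<-cmp i j
... | tri< i<j _ _ = ⊥-elim (Fin.<-irrefl eq (increasing J i<j))
... | tri≈ _ i≡j _ = i≡j
... | tri> _ _ j<i = ⊥-elim (Fin.<-irrefl (sym eq) (increasing J j<i))

module Correction {n k} (J : JuntaVariables n k) (c : BoolFun k) (μ : ℕ)
  (separating : Separating (suc μ) c) (enoughCells : 8 * (k * k) ≤ 2 ^ μ) (k>0 : 0 < k) where

  ν ℓ : ℕ
  ν = suc μ
  -- The binary logarithm of the number of ordered pairs of hypotheses.
  ℓ = suc ν * k + suc ν * k

  Hypothesis : Set
  Hypothesis = Vec (Point (suc ν)) k

  pairs : List (Hypothesis × Hypothesis)
  pairs = cartesianProduct (hypotheses ν k) (hypotheses ν k)

  length-pairs : length pairs ≡ 2 ^ ℓ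
  length-pairs = begin
    length pairs                                              ≡⟨ length-cartesianProductWith _,_ (hypotheses ν k) _ ⟩
    length (hypotheses ν k) * length (hypotheses ν k)         ≡⟨ cong₂ _*_ (length-hypotheses ν k) (length-hypotheses ν k) ⟩
    2 ^ (suc ν * k) * 2 ^ (suc ν * k)                         ≡⟨ ^-distribˡ-+-* 2 (suc ν * k) (suc ν * k) ⟨
    2 ^ ℓ                                                     ∎
    where open ≡-Reasoning

  confuses : Hypothesis × Hypothesis → BoolFun ν → Bool
  confuses (η , η′) z = not (c (reading η z) xor c (reading η′ z))

  design : Σ[ zs ∈ List (BoolFun ν) ] length zs ≡ 48 * ℓ ×
    (∀ {p} → p ∈ pairs → 8 * (∑[ z ∈ functions ν ] ⟦ confuses p z ⟧) ≤ 7 * length (functions ν) →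
             (∑[ z ∈ zs ] ⟦ confuses p z ⟧) ≤ 45 * ℓ)
  design = samples (functions ν) pairs confuses ℓ
    (subst (0 <_) (sym (length-functions ν)) (m^n>0 2 (2 ^ ν))) (≤-reflexive length-pairs)

  zs : List (BoolFun ν)
  zs = proj₁ design

  length-zs : length zs ≡ 48 * ℓ
  length-zs = proj₁ (proj₂ design)

  codeDistance : ∀ η η′ j → Spread η′ → tail (lookup η j) ≢ tail (lookup η′ j) →
    3 * ℓ ≤ (∑[ z ∈ zs ] differ (c (reading η z)) (c (reading η′ z)))
  codeDistance η η′ j spread tails≢ = +-cancelˡ-≤ (45 * ℓ) _ _ (begin
    45 * ℓ + 3 * ℓ
      ≡⟨ *-distribʳ-+ ℓ 45 3 ⟨
    48 * ℓ
      ≡⟨ trans (∑-agree+differ zs (λ z → c (reading η z)) (λ z → c (reading η′ z))) length-zs ⟨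
    (∑[ z ∈ zs ] agree (c (reading η z)) (c (reading η′ z))) + (∑[ z ∈ zs ] differ (c (reading η z)) (c (reading η′ z)))
      ≤⟨ +-monoˡ-≤ _ (proj₂ (proj₂ design) (∈-cartesianProduct⁺ (∈-hypotheses η) (∈-hypotheses η′)) (separating η η′ j spread tails≢)) ⟩
    45 * ℓ + (∑[ z ∈ zs ] differ (c (reading η z)) (c (reading η′ z))) ∎)
    where open ≤-Reasoning

  -- An entry has the form s ∷ x ∷ h, so `head ∘ tail` extracts the bit of the input point.
  target : Hypothesis → Bool
  target η = c (Vec.map (head ∘ tail) η)

  error : Hypothesis → BoolFun ν × Bool → ℕ
  error η (z , b) = differ b (c (reading η z))

  mismatch : List Bool → Hypothesis → ℕ
  mismatch answers η = ∑ (List.zip zs answers) (error η)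

  -- The threshold is half of the distance 3ℓ in `codeDistance`.
  consistent? : ∀ answers → Decidable (λ η → 2 * mismatch answers η < 3 * ℓ)
  consistent? answers η = 2 * mismatch answers η <? 3 * ℓ

  firstTarget : List Hypothesis → Bool
  -- An arbitrary default, reached only when no hypothesis is consistent.
  firstTarget []      = false
  firstTarget (η ∷ _) = target η

  decode : List Bool → Bool
  decode answers = firstTarget (filter (consistent? answers) (hypotheses ν k))

  -- Unique decoding up to signs: by the triangle inequality a consistent hypothesis lies within
  -- less than 3ℓ of `η`, hence has the same positions and the same target. It does not matter which
  -- consistent hypothesis comes first.
  decode-correct : ∀ answers η → Spread η → 2 * mismatch answers η < 3 * ℓ → length answers ≡ length zs →
    decode answers ≡ target η
  decode-correct answers η spread close sameLength = found (filter (consistent? answers) (hypotheses ν k))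
    (∈-filter⁺ (consistent? answers) (∈-hypotheses η) close)
    (λ {θ} θ∈ → proj₂ (∈-filter⁻ (consistent? answers) {xs = hypotheses ν k} θ∈))
    where
    open ≤-Reasoning

    triangle : ∀ θ (ys : List (BoolFun ν)) bs → length bs ≡ length ys →
      (∑[ z ∈ ys ] differ (c (reading θ z)) (c (reading η z)))
        ≤ ∑ (List.zip ys bs) (error θ) + ∑ (List.zip ys bs) (error η)
    triangle θ []       []       _  = z≤n
    triangle θ (z ∷ ys) (b ∷ bs) eq = ≤-trans
      (+-mono-≤ (differ-triangle (c (reading θ z)) b (c (reading η z))) (triangle θ ys bs (suc-injective eq)))
      (≤-reflexive (+-interchange (differ b (c (reading θ z))) _ _ _))

    tails≡ : ∀ θ → 2 * mismatch answers θ < 3 * ℓ → ∀ j → tail (lookup θ j) ≡ tail (lookup η j)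
    tails≡ θ θ-close j with tail (lookup θ j) ≟ᵖ tail (lookup η j)
    ... | yes eq  = eq
    ... | no  neq = ⊥-elim (<-irrefl refl (begin-strict
      2 * (3 * ℓ)                                            ≤⟨ *-monoʳ-≤ 2 (codeDistance θ η j spread neq) ⟩
      2 * (∑[ z ∈ zs ] differ (c (reading θ z)) (c (reading η z)))   ≤⟨ *-monoʳ-≤ 2 (triangle θ zs answers sameLength) ⟩
      2 * (mismatch answers θ + mismatch answers η)          ≡⟨ *-distribˡ-+ 2 (mismatch answers θ) _ ⟩
      2 * mismatch answers θ + 2 * mismatch answers η        <⟨ +-mono-< θ-close close ⟩
      3 * ℓ + 3 * ℓ                                          ≡⟨ cong (_+_ (3 * ℓ)) (+-identityʳ (3 * ℓ)) ⟨
      2 * (3 * ℓ)                                            ∎))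

    map-head-tail : ∀ {m} (θ θ′ : Vec (Point (suc ν)) m) → (∀ j → tail (lookup θ j) ≡ tail (lookup θ′ j)) →
      Vec.map (head ∘ tail) θ ≡ Vec.map (head ∘ tail) θ′
    map-head-tail []      []        eqs = refl
    map-head-tail (a ∷ θ) (a′ ∷ θ′) eqs = cong₂ _∷_ (cong head (eqs Fin.zero)) (map-head-tail θ θ′ (eqs ∘ Fin.suc))

    found : ∀ θs → η ∈ θs → (∀ {θ} → θ ∈ θs → 2 * mismatch answers θ < 3 * ℓ) → firstTarget θs ≡ target η
    found (θ ∷ _) _ consistent = cong c (map-head-tail θ η (tails≡ θ (consistent (here refl))))

  Seed : Set
  Seed = Vec (Point (suc μ)) n

  seedList : List Seed
  seedList = vectors (points (suc μ)) n

  length-seedList : length seedList ≡ (2 ^ suc μ) ^ n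
  length-seedList = trans (length-vectors (points (suc μ)) n) (cong (_^ n) (length-points (suc μ)))

  algorithm : NonAdaptiveAlgorithm n
  algorithm = record
    { seeds   = length seedList
    ; seeds≢0 = subst NonZero (sym length-seedList) (m^n≢0 (2 ^ suc μ) n {{m^n≢0 2 (suc μ)}})
    ; queries = λ r x → map (query (List.lookup seedList r) x) zs
    -- The relevant bits of x reach the decoder through the answers, since x selects the positions
    -- at which z is read.
    ; decide  = λ _ _ → decode
    }

  module _ (σ : Permutation′ n) (g : BoolFun n) (x : Point n) where

    f : BoolFun n
    f = permuteFun σ (junta J c)

    τ : Fin k → Fin n
    τ j = σ ⟨$⟩ʳ var J j

    τ-injective : ∀ {i j} → τ i ≡ τ j → i ≡ j
    τ-injective eq = var-injective J (trans (sym (inverseˡ σ)) (trans (cong (σ ⟨$⟩ˡ_) eq) (inverseˡ σ)))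

    f≡ : ∀ y → f y ≡ c (tabulate (λ j → lookup y (τ j)))
    f≡ y = cong c (tabulate-cong (λ j → lookup∘tabulate (λ i → lookup y (σ ⟨$⟩ʳ i)) (var J j)))

    truth : Seed → Hypothesis
    truth r = tabulate (λ j → head (lookup r (τ j)) ∷ lookup x (τ j) ∷ tail (lookup r (τ j)))

    -- `f` looks at a query only in the coordinates `τ j`, and there the query bit is exactly the
    -- probe of z by the j-th entry of `truth r`.
    reading-truth : ∀ r z → c (reading (truth r) z) ≡ f (query r x z)
    reading-truth r z = trans (cong c (trans (sym (tabulate-∘ (probe z) _))
      (tabulate-cong (λ j → sym (lookup-zipWith _ (τ j) x r))))) (sym (f≡ (query r x z)))

    target-truth : ∀ r → target (truth r) ≡ f x
    target-truth r = trans (cong c (sym (tabulate-∘ (head ∘ tail) _))) (sym (f≡ x))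

    answer : Seed → Bool
    answer r = decode (map g (map (query r x) zs))

    corruption : Seed → ℕ
    corruption r = ∑[ z ∈ zs ] differ (g (query r x z)) (f (query r x z))

    collide : Fin k → Fin k → Seed → ℕ
    collide i j r with i Fin.≟ j
    ... | yes _ = 0
    ... | no  _ = ⟦ same (tail (lookup r (τ i))) (tail (lookup r (τ j))) ⟧

    collisions : Seed → ℕ
    collisions r = ∑[ i ∈ allFin k ] ∑[ j ∈ allFin k ] collide i j r

    collide≤collisions : ∀ i j r → collide i j r ≤ collisions r
    collide≤collisions i j r = ≤-trans (∈⇒≤∑ (λ j → collide i j r) (∈-allFin j))
                                       (∈⇒≤∑ (λ i → ∑[ j ∈ allFin k ] collide i j r) (∈-allFin i))

    spread-truth : ∀ r → collisions r ≡ 0 → Spread (truth r)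
    spread-truth r none {i} {j} eq = byCases (i Fin.≟ j)
      where
      cells≡ : tail (lookup r (τ i)) ≡ tail (lookup r (τ j))
      cells≡ = cong tail (trans (cong tail (sym (lookup∘tabulate _ i))) (trans eq (cong tail (lookup∘tabulate _ j))))
      collide≡1 : i ≢ j → collide i j r ≡ 1
      collide≡1 i≢j with i Fin.≟ j
      ... | yes i≡j = ⊥-elim (i≢j i≡j)
      ... | no  _   = cong ⟦_⟧ (trans (cong (λ p → same p (tail (lookup r (τ j)))) cells≡) (same-refl (tail (lookup r (τ j)))))
      byCases : Dec (i ≡ j) → i ≡ j
      byCases (yes i≡j) = i≡j
      byCases (no  i≢j) = ⊥-elim (1+n≢0 (n≤0⇒n≡0 (begin
        1               ≡⟨ collide≡1 i≢j ⟨
        collide i j r   ≤⟨ collide≤collisions i j r ⟩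
        collisions r    ≡⟨ none ⟩
        0               ∎)))
        where open ≤-Reasoning

    answer-correct : ∀ r → collisions r ≡ 0 → 2 * corruption r < 3 * ℓ → answer r ≡ f x
    answer-correct r none close = trans
      (decode-correct answers (truth r) (spread-truth r none) (subst (λ m → 2 * m < 3 * ℓ) (sym mismatch≡) close)
        (trans (length-map g (map (query r x) zs)) (length-map (query r x) zs)))
      (target-truth r)
      where
      answers = map g (map (query r x) zs)
      mismatch≡ : mismatch answers (truth r) ≡ corruption r
      mismatch≡ = trans (cong (λ bs → ∑ (List.zip zs bs) (error (truth r))) (sym (map-∘ zs)))
        (trans (∑-zip-map (error (truth r)) (g ∘ query r x) zs)
               (∑-cong zs (λ z → cong (differ (g (query r x z))) (reading-truth r z))))

    -- A failure requires a collision or at least 3ℓ/2 corrupted answers. After scaling by 3ℓ both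
    -- causes fit into one linear inequality, and summing it over the seeds performs the union bound
    -- and Markov's inequality at once.
    failure≤ : ∀ r → 3 * ℓ * differ (answer r) (f x) ≤ 3 * ℓ * collisions r + 2 * corruption r
    failure≤ r = byCases (collisions r) refl (2 * corruption r <? 3 * ℓ)
      where
      open ≤-Reasoning
      byCases : ∀ l → collisions r ≡ l → Dec (2 * corruption r < 3 * ℓ) →
        3 * ℓ * differ (answer r) (f x) ≤ 3 * ℓ * l + 2 * corruption r
      byCases (suc l) eq _ = begin
        3 * ℓ * differ (answer r) (f x)   ≤⟨ *-monoʳ-≤ (3 * ℓ) (≤-trans (⟦⟧≤1 (answer r xor f x)) (s≤s z≤n)) ⟩
        3 * ℓ * suc l                     ≤⟨ m≤m+n _ _ ⟩
        3 * ℓ * suc l + 2 * corruption r  ∎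
      byCases zero eq (yes close) = begin
        3 * ℓ * differ (answer r) (f x)   ≡⟨ cong (λ u → 3 * ℓ * differ u (f x)) (answer-correct r eq close) ⟩
        3 * ℓ * differ (f x) (f x)        ≡⟨ trans (cong (3 * ℓ *_) (differ-refl (f x))) (*-zeroʳ (3 * ℓ)) ⟩
        0                                 ≤⟨ z≤n ⟩
        3 * ℓ * 0 + 2 * corruption r      ∎
      byCases zero eq (no far) = begin
        3 * ℓ * differ (answer r) (f x)   ≤⟨ *-monoʳ-≤ (3 * ℓ) (⟦⟧≤1 (answer r xor f x)) ⟩
        3 * ℓ * 1                         ≡⟨ *-identityʳ (3 * ℓ) ⟩
        3 * ℓ                             ≤⟨ ≮⇒≥ far ⟩
        2 * corruption r                  ≤⟨ m≤n+m _ (3 * ℓ * 0) ⟩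
        3 * ℓ * 0 + 2 * corruption r      ∎

    R = length seedList

    ∑-collide : ∀ i j → 2 ^ μ * ∑ seedList (collide i j) ≤ R
    ∑-collide i j with i Fin.≟ j
    ... | yes _   = ≤-trans (≤-reflexive (trans (cong (2 ^ μ *_) (trans (∑-const seedList 0) (*-zeroʳ R))) (*-zeroʳ (2 ^ μ)))) z≤n
    ... | no  i≢j = ≤-reflexive (∑-collision μ (i≢j ∘ τ-injective))

    -- There are at most k² ordered pairs, each colliding for at most a fraction 2^(-μ) ≤ 1/(8k²) of
    -- the seeds.
    ∑-collisions : 8 * ∑ seedList collisions ≤ R
    ∑-collisions = *-cancelˡ-≤ (2 ^ μ) {{m^n≢0 2 μ}} (begin
      2 ^ μ * (8 * ∑ seedList collisions)
        ≡⟨ swap (2 ^ μ) (∑ seedList collisions) ⟩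
      8 * (2 ^ μ * ∑ seedList collisions)
        ≡⟨ cong (λ s → 8 * (2 ^ μ * s)) (trans (∑-swap seedList I _) (∑-cong I (λ i → ∑-swap seedList I _))) ⟩
      8 * (2 ^ μ * (∑[ i ∈ I ] ∑[ j ∈ I ] ∑ seedList (collide i j)))
        ≡⟨ cong (8 *_) (trans (sym (∑-* I (2 ^ μ) _)) (∑-cong I (λ i → sym (∑-* I (2 ^ μ) _)))) ⟩
      8 * (∑[ i ∈ I ] ∑[ j ∈ I ] (2 ^ μ * ∑ seedList (collide i j)))
        ≤⟨ *-monoʳ-≤ 8 (∑-mono I (λ i → ∑-mono I (λ j → ∑-collide i j))) ⟩
      8 * (∑[ _ ∈ I ] ∑[ _ ∈ I ] R)
        ≡⟨ cong (8 *_) (trans (∑-const I _) (cong₂ _*_ length-I (trans (∑-const I R) (cong (_* R) length-I)))) ⟩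
      8 * (k * (k * R))
        ≡⟨ regroup k R ⟩
      8 * (k * k) * R
        ≤⟨ *-monoˡ-≤ R enoughCells ⟩
      2 ^ μ * R ∎)
      where
      open ≤-Reasoning
      I = allFin k
      length-I : length I ≡ k
      length-I = length-tabulate {n = k} id
      swap : ∀ a b → a * (8 * b) ≡ 8 * (a * b)
      swap = solve-∀
      regroup : ∀ a b → 8 * (a * (a * b)) ≡ 8 * (a * a) * b
      regroup = solve-∀

    module _ (close : Close (+ 1 / 1000) g f) where
      open ≤-Reasoning

      D = ∑[ y ∈ points n ] differ (g y) (f y)

      D≤ : D * 1000 ≤ 2 ^ n
      D≤ = begin
        D * 1000     ≡⟨ cong (_* 1000) (length-filter-differ g f (points n)) ⟨
        length (filter (λ y → ¬? (g y ≟ f y)) (points n)) * 1000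
                     ≤⟨ /-≤⁻¹ _ (2 ^ n) 1 1000 {{m^n≢0 2 n}} close ⟩
        1 * 2 ^ n    ≡⟨ *-identityˡ (2 ^ n) ⟩
        2 ^ n        ∎

      ∑-corruption : 1000 * ∑ seedList corruption ≤ 48 * ℓ * R
      ∑-corruption = begin
        1000 * ∑ seedList corruption
          ≡⟨ cong (1000 *_) (trans (∑-swap seedList zs _) (trans (∑-cong zs (λ z → ∑-query μ x z (λ y → differ (g y) (f y)))) (∑-const zs _))) ⟩
        1000 * (length zs * ((2 ^ μ) ^ n * D))
          ≡⟨ regroup (length zs) ((2 ^ μ) ^ n) D ⟩
        length zs * ((2 ^ μ) ^ n * (D * 1000))
          ≤⟨ *-monoʳ-≤ (length zs) (*-monoʳ-≤ ((2 ^ μ) ^ n) D≤) ⟩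
        length zs * ((2 ^ μ) ^ n * 2 ^ n)
          ≡⟨ cong₂ _*_ length-zs (trans power (sym length-seedList)) ⟩
        48 * ℓ * R ∎
        where
        regroup : ∀ a b d → 1000 * (a * (b * d)) ≡ a * (b * (d * 1000))
        regroup = solve-∀
        power : (2 ^ μ) ^ n * 2 ^ n ≡ (2 ^ suc μ) ^ n
        power = begin-equality
          (2 ^ μ) ^ n * 2 ^ n      ≡⟨ cong (_* 2 ^ n) (^-*-assoc 2 μ n) ⟩
          2 ^ (μ * n) * 2 ^ n      ≡⟨ ^-distribˡ-+-* 2 (μ * n) n ⟨
          2 ^ (μ * n + n)          ≡⟨ cong (2 ^_) (+-comm (μ * n) n) ⟩
          2 ^ (suc μ * n)          ≡⟨ ^-*-assoc 2 (suc μ) n ⟨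
          (2 ^ suc μ) ^ n          ∎

      failures successes : ℕ
      failures  = ∑[ r ∈ seedList ] differ (answer r) (f x)
      successes = ∑[ r ∈ seedList ] agree (answer r) (f x)

      ℓ≢0 : NonZero ℓ
      ℓ≢0 = >-nonZero (≤-trans k>0 (≤-trans (m≤n*m k (suc ν)) (m≤m+n _ _)))

      failures-rare : 3 * failures ≤ R
      failures-rare = *-cancelˡ-≤ (1000 * ℓ) {{m*n≢0 1000 ℓ {{_}} {{ℓ≢0}}}} (begin
        1000 * ℓ * (3 * failures)
          ≡⟨ regroup₁ ℓ failures ⟩
        1000 * (3 * ℓ * failures)
          ≡⟨ cong (1000 *_) (∑-* seedList (3 * ℓ) _) ⟨
        1000 * (∑[ r ∈ seedList ] (3 * ℓ * differ (answer r) (f x)))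
          ≤⟨ *-monoʳ-≤ 1000 (∑-mono seedList failure≤) ⟩
        1000 * (∑[ r ∈ seedList ] (3 * ℓ * collisions r + 2 * corruption r))
          ≡⟨ cong (1000 *_) (trans (∑-+ seedList _ _) (cong₂ _+_ (∑-* seedList (3 * ℓ) collisions) (∑-* seedList 2 corruption))) ⟩
        1000 * (3 * ℓ * ∑ seedList collisions + 2 * ∑ seedList corruption)
          ≡⟨ regroup₂ ℓ (∑ seedList collisions) (∑ seedList corruption) ⟩
        375 * ℓ * (8 * ∑ seedList collisions) + 2 * (1000 * ∑ seedList corruption)
          ≤⟨ +-mono-≤ (*-monoʳ-≤ (375 * ℓ) ∑-collisions) (*-monoʳ-≤ 2 ∑-corruption) ⟩
        375 * ℓ * R + 2 * (48 * ℓ * R)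
          -- In units of ℓR, collisions account for 375 and corruption for 96, out of an allowance
          -- of 1000; 529 is the slack.
          ≤⟨ m≤m+n _ (529 * ℓ * R) ⟩
        375 * ℓ * R + 2 * (48 * ℓ * R) + 529 * ℓ * R
          ≡⟨ regroup₃ ℓ R ⟩
        1000 * ℓ * R ∎)
        where
        regroup₁ : ∀ l a → 1000 * l * (3 * a) ≡ 1000 * (3 * l * a)
        regroup₁ = solve-∀
        regroup₂ : ∀ l a b → 1000 * (3 * l * a + 2 * b) ≡ 375 * l * (8 * a) + 2 * (1000 * b)
        regroup₂ = solve-∀
        regroup₃ : ∀ l s → 375 * l * s + 2 * (48 * l * s) + 529 * l * s ≡ 1000 * l * s
        regroup₃ = solve-∀

      successes-frequent : 2 * R ≤ successes * 3
      successes-frequent = +-cancelʳ-≤ R _ _ (begin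
        2 * R + R                          ≡⟨ +-comm (2 * R) R ⟩
        3 * R                              ≡⟨ cong (3 *_) (∑-agree+differ seedList answer (λ _ → f x)) ⟨
        3 * (successes + failures)         ≡⟨ trans (*-distribˡ-+ 3 successes failures) (cong (_+ 3 * failures) (*-comm 3 successes)) ⟩
        successes * 3 + 3 * failures       ≤⟨ +-monoʳ-≤ (successes * 3) failures-rare ⟩
        successes * 3 + R                  ∎)

      success : + 2 / 3 ≤ᵘ Pr[run_at_≡_] algorithm g x (f x)
      success = /-≤ 2 3 _ R {{_}} {{seeds≢0 algorithm}} (begin
        2 * R           ≤⟨ successes-frequent ⟩
        successes * 3   ≡⟨ cong (_* 3) (trans (length-filter-agree (λ s → run algorithm g s x) (f x) (allFin R))
                                       (∑-allFin-lookup seedList (λ r → agree (answer r) (f x)))) ⟨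
        length (filter (λ s → run algorithm g s x ≟ f x) (allFin R)) * 3 ∎)

  correctable : NonAdaptivelyLocallyCorrectable (48 * ℓ) (+ 1 / 1000) (junta J c)
  correctable = algorithm
    , (λ r x → ≤-reflexive (trans (length-map (query (List.lookup seedList r) x) zs) length-zs))
    , (λ σ g close x → success σ g x close)

-- Choice of the parameters

n<2^n : ∀ n → n < 2 ^ n
n<2^n zero    = s≤s z≤n
n<2^n (suc n) = begin-strict
  suc n           ≤⟨ n<2^n n ⟩
  2 ^ n           <⟨ m<m+n (2 ^ n) (m^n>0 2 n) ⟩
  2 ^ n + 2 ^ n   ≡⟨ cong (_+_ (2 ^ n)) (+-identityʳ (2 ^ n)) ⟨
  2 ^ suc n       ∎
  where open ≤-Reasoning

2^⌊log₂⌋≤ : ∀ n → 0 < n → 2 ^ ⌊log₂ n ⌋ ≤ n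
2^⌊log₂⌋≤ = <-rec (λ n → 0 < n → 2 ^ ⌊log₂ n ⌋ ≤ n) step
  where
  open ≤-Reasoning
  step : ∀ n → (∀ {m} → m < n → 0 < m → 2 ^ ⌊log₂ m ⌋ ≤ m) → 0 < n → 2 ^ ⌊log₂ n ⌋ ≤ n
  step 1               rec _ = ≤-refl
  step n@(suc (suc m)) rec _ = begin
    2 ^ ⌊log₂ n ⌋                ≤⟨ ^-monoʳ-≤ 2 (m≤n+m∸n ⌊log₂ n ⌋ 1) ⟩
    2 ^ suc (⌊log₂ n ⌋ ∸ 1)      ≡⟨ cong (λ e → 2 ^ suc e) (⌊log₂⌊n/2⌋⌋≡⌊log₂n⌋∸1 n) ⟨
    2 * 2 ^ ⌊log₂ ⌊ n /2⌋ ⌋      ≤⟨ *-monoʳ-≤ 2 (rec (⌊n/2⌋<n (suc m)) (s≤s z≤n)) ⟩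
    2 * ⌊ n /2⌋                  ≡⟨ cong (_+_ ⌊ n /2⌋) (+-identityʳ ⌊ n /2⌋) ⟩
    ⌊ n /2⌋ + ⌊ n /2⌋            ≤⟨ +-monoʳ-≤ ⌊ n /2⌋ (⌊n/2⌋≤⌈n/2⌉ n) ⟩
    ⌊ n /2⌋ + ⌈ n /2⌉            ≡⟨ ⌊n/2⌋+⌈n/2⌉≡n n ⟩
    n                            ∎

<2^1+⌊log₂⌋ : ∀ n → n < 2 ^ suc ⌊log₂ n ⌋
<2^1+⌊log₂⌋ n = ≰⇒> (λ le → <-irrefl refl (≤-trans (≤-reflexive (sym (⌊log₂[2^n]⌋≡n (suc ⌊log₂ n ⌋)))) (⌊log₂⌋-mono-≤ le)))

-- The numerator bounds the number of events (`fewEvents`), and each event spoils a fraction 2^(-m)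
-- of the cores, with m = 2^(k-5).
δ : ℕ → ℚᵘ
δ k = (+ (2 ^ (83 * (k * k))) / (2 ^ (2 ^ (k ∸ 5)))) {{m^n≢0 2 (2 ^ (k ∸ 5))}}

-- Here k = i + 30, and the exponent is k - 5 as in `δ`. The coefficient is 83 + 1: the additional
-- k² absorbs the denominator of the tolerance, which is at most k and so less than 2^k.
quadratic≤exponential : ∀ i → 84 * ((i + 30) * (i + 30)) ≤ 2 ^ (i + 25)
quadratic≤exponential zero    = ≤ᵇ⇒≤ _ _ _
quadratic≤exponential (suc i) = begin
  84 * (suc k * suc k)    ≤⟨ *-monoʳ-≤ 84 square-suc ⟩
  84 * (2 * (k * k))      ≡⟨ swap 84 (k * k) ⟩
  2 * (84 * (k * k))      ≤⟨ *-monoʳ-≤ 2 (quadratic≤exponential i) ⟩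
  2 * 2 ^ (i + 25)        ∎
  where
  open ≤-Reasoning
  k = i + 30

  swap : ∀ a b → a * (2 * b) ≡ 2 * (a * b)
  swap = solve-∀

  3≤k : 3 ≤ k
  3≤k = ≤-trans (≤ᵇ⇒≤ 3 30 _) (m≤n+m 30 i)

  expand : ∀ a → suc a * suc a ≡ a * a + (1 + 2 * a)
  expand = solve-∀

  square-suc : suc k * suc k ≤ 2 * (k * k)
  square-suc = begin
    suc k * suc k          ≡⟨ expand k ⟩
    k * k + (1 + 2 * k)    ≤⟨ +-monoʳ-≤ (k * k) (+-monoˡ-≤ (2 * k) (≤-trans (s≤s z≤n) 3≤k)) ⟩
    k * k + 3 * k          ≤⟨ +-monoʳ-≤ (k * k) (*-monoˡ-≤ k 3≤k) ⟩
    k * k + k * k          ≡⟨ cong (_+_ (k * k)) (+-identityʳ (k * k)) ⟨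
    2 * (k * k)            ∎

δ→0 : TendsToZero δ
δ→0 (mkℚᵘ (ℤ.+ zero)     d) (*<* (ℤ.+<+ ()))
δ→0 (mkℚᵘ (ℤ.+ suc a)    d) _ = suc d + 30 , λ k K≤k → below k K≤k (m≤n⇒∃[o]m+o≡n (≤-trans (m≤n+m 30 (suc d)) K≤k))
  where
  open ≤-Reasoning

  ∣/∣-< : ∀ p q .{{_ : NonZero q}} → p * suc d < suc a * q → ∣ + p / q ∣ <ᵘ mkℚᵘ (ℤ.+ suc a) d
  ∣/∣-< p (suc q) lt = *<* (subst₂ ℤ._<_ (ℤ.pos-* p (suc d)) (ℤ.pos-* (suc a) (suc q)) (ℤ.+<+ lt))

  below : ∀ k → suc d + 30 ≤ k → (∃[ o ] 30 + o ≡ k) → ∣ δ k ∣ <ᵘ mkℚᵘ (ℤ.+ suc a) d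
  below k K≤k (o , 30+o≡k) = ∣/∣-< (2 ^ (83 * (k * k))) (2 ^ (2 ^ (k ∸ 5))) {{m^n≢0 2 (2 ^ (k ∸ 5))}} (begin-strict
    2 ^ (83 * (k * k)) * suc d             <⟨ *-monoʳ-< (2 ^ (83 * (k * k))) {{m^n≢0 2 (83 * (k * k))}} (n<2^n (suc d)) ⟩
    2 ^ (83 * (k * k)) * 2 ^ suc d         ≡⟨ ^-distribˡ-+-* 2 (83 * (k * k)) (suc d) ⟨
    2 ^ (83 * (k * k) + suc d)             ≤⟨ ^-monoʳ-≤ 2 exponent ⟩
    2 ^ (2 ^ (k ∸ 5))                      ≤⟨ m≤n*m _ (suc a) ⟩
    suc a * 2 ^ (2 ^ (k ∸ 5))              ∎)
    where
    k≡o+30 : k ≡ o + 30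
    k≡o+30 = trans (sym 30+o≡k) (+-comm 30 o)

    k∸5≡ : k ∸ 5 ≡ o + 25
    k∸5≡ = trans (cong (_∸ 5) (sym 30+o≡k)) (+-comm 25 o)

    d≤k : suc d ≤ k
    d≤k = ≤-trans (m≤m+n (suc d) 30) K≤k

    exponent : 83 * (k * k) + suc d ≤ 2 ^ (k ∸ 5)
    exponent = begin
      83 * (k * k) + suc d     ≤⟨ +-monoʳ-≤ (83 * (k * k)) (≤-trans d≤k (m≤m*n k k {{>-nonZero (≤-trans (s≤s z≤n) d≤k)}})) ⟩
      83 * (k * k) + k * k     ≡⟨ +-comm (83 * (k * k)) (k * k) ⟩
      84 * (k * k)             ≡⟨ cong (λ x → 84 * (x * x)) k≡o+30 ⟩
      84 * ((o + 30) * (o + 30)) ≤⟨ quadratic≤exponential o ⟩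
      2 ^ (o + 25)             ≡⟨ cong (2 ^_) k∸5≡ ⟨
      2 ^ (k ∸ 5)              ∎

CorrectableWithin : ∀ {n k} → JuntaVariables n k → ℕ → BoolFun k → Set
CorrectableWithin {n} {k} J B core = ∃[ q ] (q ≤ B × NonAdaptivelyLocallyCorrectable q (+ 1 / 1000) (junta J core))

module Parameters {k Λ : ℕ} (Λ>0 : 0 < Λ) (2^Λ≤k : 2 ^ Λ ≤ k) (k<2^1+Λ : k < 2 ^ suc Λ) where
  open ≤-Reasoning

  μ ν : ℕ
  -- The table has 32 * 4^Λ cells. From k < 2^(1+Λ) this is at least 8k², and from 2^Λ ≤ k it is
  -- O(k²), which keeps the number 2^(2^ν) of functions z within 2^(64k²).
  μ = 5 + (Λ + Λ)
  ν = suc μ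

  k>0 : 0 < k
  k>0 = ≤-trans (m^n>0 2 Λ) 2^Λ≤k

  Λ≤k : Λ ≤ k
  Λ≤k = ≤-trans (<⇒≤ (n<2^n Λ)) 2^Λ≤k

  2^cells : ∀ c → 2 ^ (c + (Λ + Λ)) ≡ 2 ^ c * (2 ^ Λ * 2 ^ Λ)
  2^cells c = trans (^-distribˡ-+-* 2 c (Λ + Λ)) (cong (2 ^ c *_) (^-distribˡ-+-* 2 Λ Λ))

  enoughCells : 8 * (k * k) ≤ 2 ^ μ
  enoughCells = begin
    8 * (k * k)                      ≤⟨ *-monoʳ-≤ 8 (*-mono-≤ (<⇒≤ k<2^1+Λ) (<⇒≤ k<2^1+Λ)) ⟩
    8 * (2 * 2 ^ Λ * (2 * 2 ^ Λ))    ≡⟨ regroup (2 ^ Λ) ⟩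
    32 * (2 ^ Λ * 2 ^ Λ)             ≡⟨ 2^cells 5 ⟨
    2 ^ μ                            ∎
    where
    regroup : ∀ x → 8 * (2 * x * (2 * x)) ≡ 32 * (x * x)
    regroup = solve-∀

  1+ν≤9Λ : suc ν ≤ 9 * Λ
  1+ν≤9Λ = begin
    7 + (Λ + Λ)         ≤⟨ +-monoˡ-≤ (Λ + Λ) (*-monoʳ-≤ 7 Λ>0) ⟩
    7 * Λ + (Λ + Λ)     ≡⟨ regroup Λ ⟩
    9 * Λ               ∎
    where
    regroup : ∀ x → 7 * x + (x + x) ≡ 9 * x
    regroup = solve-∀

  fewQueries : 48 * (suc ν * k + suc ν * k) ≤ 864 * (k * Λ ^ 2)
  fewQueries = begin
    48 * (suc ν * k + suc ν * k)    ≤⟨ *-monoʳ-≤ 48 (+-mono-≤ (*-monoˡ-≤ k 1+ν≤9Λ) (*-monoˡ-≤ k 1+ν≤9Λ)) ⟩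
    48 * (9 * Λ * k + 9 * Λ * k)    ≡⟨ regroup Λ k ⟩
    -- The construction itself spends O(kΛ) queries; the second factor Λ ≥ 1 is only inserted to
    -- meet the stated bound.
    864 * (k * Λ)                   ≤⟨ *-monoʳ-≤ 864 (*-monoʳ-≤ k (m≤m*n Λ (Λ ^ 1) {{m^n≢0 Λ 1 {{>-nonZero Λ>0}}}})) ⟩
    864 * (k * Λ ^ 2)               ∎
    where
    regroup : ∀ x y → 48 * (9 * x * y + 9 * x * y) ≡ 864 * (y * x)
    regroup = solve-∀

  -- The exponent 83 is 9 + 9 for the two hypotheses, 1 for the coordinate j and 64 for z. The last
  -- dominates, because the union bound ranges over all contents of a table of O(k²) entries.
  fewEvents : (2 ^ (suc ν * k) * 2 ^ (suc ν * k)) * (k * 2 ^ (2 ^ ν)) ≤ 2 ^ (83 * (k * k))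
  fewEvents = begin
    (2 ^ (suc ν * k) * 2 ^ (suc ν * k)) * (k * 2 ^ (2 ^ ν))
      ≤⟨ *-monoʳ-≤ (2 ^ (suc ν * k) * 2 ^ (suc ν * k)) (*-monoˡ-≤ (2 ^ (2 ^ ν)) (<⇒≤ (n<2^n k))) ⟩
    (2 ^ (suc ν * k) * 2 ^ (suc ν * k)) * (2 ^ k * 2 ^ (2 ^ ν))
      ≡⟨ cong₂ _*_ (^-distribˡ-+-* 2 (suc ν * k) (suc ν * k)) (^-distribˡ-+-* 2 k (2 ^ ν)) ⟨
    2 ^ (suc ν * k + suc ν * k) * 2 ^ (k + 2 ^ ν)
      ≡⟨ ^-distribˡ-+-* 2 (suc ν * k + suc ν * k) (k + 2 ^ ν) ⟨
    2 ^ (suc ν * k + suc ν * k + (k + 2 ^ ν))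
      ≤⟨ ^-monoʳ-≤ 2 (+-mono-≤ (+-mono-≤ cells cells) (+-mono-≤ (m≤m*n k k {{>-nonZero k>0}}) 2^ν≤)) ⟩
    2 ^ (9 * (k * k) + 9 * (k * k) + (k * k + 64 * (k * k)))
      ≡⟨ cong (2 ^_) (regroup (k * k)) ⟩
    2 ^ (83 * (k * k)) ∎
    where
    regroup : ∀ x → 9 * x + 9 * x + (x + 64 * x) ≡ 83 * x
    regroup = solve-∀
    cells : suc ν * k ≤ 9 * (k * k)
    cells = ≤-trans (*-monoˡ-≤ k (≤-trans 1+ν≤9Λ (*-monoʳ-≤ 9 Λ≤k))) (≤-reflexive (*-assoc 9 k k))
    2^ν≤ : 2 ^ ν ≤ 64 * (k * k)
    2^ν≤ = ≤-trans (≤-reflexive (2^cells 6)) (*-monoʳ-≤ 64 (*-mono-≤ 2^Λ≤k 2^Λ≤k))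

largeCores : ∀ {n} κ Λ → 0 < Λ → 2 ^ Λ ≤ 5 + κ → 5 + κ < 2 ^ suc Λ → (J : JuntaVariables n (5 + κ)) →
  AllButFraction (δ (5 + κ)) (CorrectableWithin J (864 * ((5 + κ) * Λ ^ 2)))
largeCores {n} κ Λ Λ>0 lower upper J = bad , /-≤ (length bad) (2 ^ (2 ^ k)) (2 ^ (83 * (k * k))) (2 ^ (2 ^ κ)) {{m^n≢0 2 (2 ^ k)}} {{m^n≢0 2 (2 ^ κ)}} rare , good
  where
  open Parameters Λ>0 lower upper
  open RandomCore κ ν using (bad; bad-rare; length-indices; potential; potential-cong; separating; m)
  k = 5 + κ

  rare : length bad * 2 ^ (2 ^ κ) ≤ 2 ^ (83 * (k * k)) * 2 ^ (2 ^ k)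
  rare = ≤-trans bad-rare (*-monoˡ-≤ (2 ^ (2 ^ k)) (≤-trans (≤-reflexive length-indices) fewEvents))

  good : ∀ c → ¬ Any (c ≗_) bad → CorrectableWithin J (864 * (k * Λ ^ 2)) c
  good c c∉bad = 48 * (suc ν * k + suc ν * k) , fewQueries ,
    Correction.correctable J c μ (separating {c} (≰⇒> (c∉bad ∘ isBad (represented c)))) enoughCells k>0
    where
    isBad : (Σ[ c′ ∈ BoolFun k ] c′ ∈ functions k × c ≗ c′) → 4 ^ (6 * m) ≤ potential c → Any (c ≗_) bad
    -- The list `bad` is filtered from the enumeration, so a core of high potential is found there
    -- through its pointwise equal representative.
    isBad (c′ , c′∈ , c≗c′) high = lose (∈-filter⁺ (λ c → 4 ^ (6 * m) ≤? potential c) c′∈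
      (subst (4 ^ (6 * m) ≤_) (potential-cong c≗c′) high)) c≗c′

-- For k < 5 the bound δ k exceeds 1, and all cores may be exceptional.
allButAll : ∀ {k} (P : BoolFun k → Set) → 2 ≤ k → k < 5 → AllButFraction (δ k) P
allButAll {k} P 2≤k k<5 = functions k , /-≤ (length (functions k)) (2 ^ (2 ^ k)) (2 ^ (83 * (k * k))) (2 ^ (2 ^ (k ∸ 5))) {{m^n≢0 2 (2 ^ k)}} {{m^n≢0 2 (2 ^ (k ∸ 5))}} trivial
  , λ c c∉ → ⊥-elim (let c′ , c′∈ , c≗c′ = represented c in c∉ (lose c′∈ c≗c′))
  where
  open ≤-Reasoning
  trivial : length (functions k) * 2 ^ (2 ^ (k ∸ 5)) ≤ 2 ^ (83 * (k * k)) * 2 ^ (2 ^ k)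
  trivial = begin
    length (functions k) * 2 ^ (2 ^ (k ∸ 5))   ≡⟨ *-comm (length (functions k)) _ ⟩
    2 ^ (2 ^ (k ∸ 5)) * length (functions k)   ≡⟨ cong₂ _*_ (cong (λ e → 2 ^ (2 ^ e)) (m≤n⇒m∸n≡0 (<⇒≤ k<5))) (length-functions k) ⟩
    2 ^ 1 * 2 ^ (2 ^ k)                        ≤⟨ *-monoˡ-≤ (2 ^ (2 ^ k)) (^-monoʳ-≤ 2 (*-mono-≤ {1} {83} (s≤s z≤n) (*-mono-≤ 1≤k 1≤k))) ⟩
    2 ^ (83 * (k * k)) * 2 ^ (2 ^ k)           ∎
    where
    1≤k : 1 ≤ k
    1≤k = ≤-trans (s≤s z≤n) 2≤k

theorem1p1 : Σ[ C ∈ ℕ ] 0 < C ×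
    (Σ[ δ ∈ (ℕ → ℚᵘ) ] TendsToZero δ ×
    (∀ (n k : ℕ) → 2 ≤ k → k ≤ n → (J : JuntaVariables n k) →
    AllButFraction {k} (δ k) (λ core →
    ∃[ q ] (q ≤ queryBound C k ×
    NonAdaptivelyLocallyCorrectable q (+ 1 / 1000) (junta J core)))))
theorem1p1 = 864 , s≤s z≤n , δ , δ→0 , λ n k 2≤k _ J → main k 2≤k J (5 ≤? k)
  where
  main : ∀ {n} k → 2 ≤ k → (J : JuntaVariables n k) → Dec (5 ≤ k) → AllButFraction (δ k) (CorrectableWithin J (queryBound 864 k))
  main k 2≤k J (no k≱5) = allButAll _ 2≤k (≰⇒> k≱5)
  main k 2≤k J (yes 5≤k) with m≤n⇒∃[o]m+o≡n 5≤k
  ... | κ , refl = largeCores κ ⌊log₂ k ⌋ (⌊log₂⌋-mono-≤ 2≤k) (2^⌊log₂⌋≤ k (≤-trans (s≤s z≤n) 2≤k)) (<2^1+⌊log₂⌋ k) J
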